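{- For every integer $m\ge 1$ there exist constants $c_m>0$ and $a_m>0$ such that for all $n\ge 1$, \[sat(Q_n,Q_m)\le \frac{c_m}{n^{a_m}}\, e(Q_n),\] where one may take $a_1=1$ and $a_m=\frac{1}{7\cdot 3^{m-2}}$ for all $m>1$.
   Context: $Q_n$ is the $n$-dimensional hypercube: vertex set $\{0,1\}^n$, two vertices adjacent iff they differ in exactly one coordinate; $e(Q_n)=n2^{n-1}$. A copy of $F$ in $G$ is a subgraph of $G$ isomorphic to $F$; $G$ is $F$-free if it has no copy of $F$. A graph $G$ is $(Q_n,F)$-saturated if $G$ is a subgraph of $Q_n$, $G$ is $F$-free, and adding any edge of $E(Q_n)\setminus E(G)$ creates a copy of $F$. $sat(Q_n,F)$ is the minimum number of edges of a $(Q_n,F)$-saturated graph. -}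

module Defs where

open import Data.Bool.Base using (Bool; true; false; if_then_else_)
import Data.Bool.Properties as Bool
open import Data.Integer.Base using (+_; ∣_∣)
open import Data.List.Base using (List; []; _∷_; length; filter; cartesianProductWith)
open import Data.List.Membership.Propositional using (_∈_)
open import Data.List.Membership.Propositional.Properties using (∈-cartesianProductWith⁺)
open import Data.List.Relation.Unary.All using ([]; _∷_)
open import Data.List.Relation.Unary.AllPairs using ([]; _∷_)
open import Data.List.Relation.Unary.Any using (here; there)
open import Data.List.Relation.Unary.Unique.Propositional using (Unique)
open import Data.List.Relation.Unary.Unique.Propositional.Properties using (cartesianProductWith⁺)
open import Data.Nat.Base using (ℕ; zero; suc; _+_; _*_; _^_; _≤_; NonZero)
open import Data.Nat.Properties using (_≟_; m*n≢0; m^n≢0)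
open import Data.Product.Base using (_×_; _,_; ∃-syntax)
open import Data.Rational.Base using (ℚ; 1ℚ; _/_; ↥_; ↧ₙ_)
open import Data.Sum.Base using (_⊎_; inj₁; inj₂; [_,_])
import Data.Sum.Base as Sum
open import Data.Vec.Base using (Vec; []; _∷_)
open import Data.Vec.Properties using (≡-dec; ∷-injective)
open import Function.Definitions using (Injective)
open import Relation.Binary.Definitions using (Decidable; DecidableEquality; Symmetric)
open import Relation.Binary.PropositionalEquality using (_≡_; _≢_; refl; sym; trans; subst)
open import Relation.Nullary.Decidable using (does; _×-dec_; _⊎-dec_)
open import Relation.Nullary.Negation using (¬_)

record Graph (V : Set) : Set₁ where
  field
    Adj         : V → V → Set
    adj?        : Decidable Adj
    symmetric   : Symmetric Adj
    irreflexive : ∀ {v} → ¬ Adj v v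

  adj⇒≢ : ∀ {u v} → Adj u v → u ≢ v
  adj⇒≢ uv refl = irreflexive uv

open Graph public using (Adj; adj⇒≢)

-- Subgraphs are spanning: only the edge set varies.
_⊆_ : {V : Set} → Graph V → Graph V → Set
G ⊆ H = ∀ {u v} → Adj G u v → Adj H u v

addEdge : {V : Set} → DecidableEquality V → (G : Graph V) (u v : V) → u ≢ v → Graph V
addEdge _≟ᵛ_ G u v u≢v = record
  { Adj         = λ x y → Adj G x y ⊎ ((x ≡ u × y ≡ v) ⊎ (x ≡ v × y ≡ u))
  ; adj?        = λ x y → Graph.adj? G x y ⊎-dec
                    (((x ≟ᵛ u) ×-dec (y ≟ᵛ v)) ⊎-dec ((x ≟ᵛ v) ×-dec (y ≟ᵛ u)))
  ; symmetric   = Sum.map (Graph.symmetric G)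
                    [ (λ { (p , q) → inj₂ (q , p) }) , (λ { (p , q) → inj₁ (q , p) }) ]
  ; irreflexive = [ Graph.irreflexive G
                  , [ (λ { (p , q) → u≢v (trans (sym p) q) })
                    , (λ { (p , q) → u≢v (trans (sym q) p) }) ] ]
  }

-- The copy itself is the subgraph of G with vertices f x and edges f x f y,
-- for x a vertex and xy an edge of F. It need not be induced.
HasCopy : {W V : Set} → Graph W → Graph V → Set
HasCopy F G = ∃[ f ] (Injective _≡_ _≡_ f × (∀ {x y} → Adj F x y → Adj G (f x) (f y)))

record Saturated {V W : Set} (_≟ᵛ_ : DecidableEquality V)
                 (H : Graph V) (F : Graph W) (G : Graph V) : Set where
  field
    subgraph : G ⊆ H
    free     : ¬ HasCopy F G
    maximal  : ∀ u v (uv : Adj H u v) → ¬ Adj G u v →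
               HasCopy F (addEdge _≟ᵛ_ G u v (adj⇒≢ H uv))

-- Adjacent pairs of list positions i < j: when vs lists every vertex exactly once,
-- each edge is counted once.
edgeCount : {V : Set} → Graph V → List V → ℕ
edgeCount G []       = 0
edgeCount G (v ∷ vs) = length (filter (Graph.adj? G v) vs) + edgeCount G vs

Vertex : ℕ → Set
Vertex n = Vec Bool n

_≟ᵛ_ : ∀ {n} → DecidableEquality (Vertex n)
_≟ᵛ_ = ≡-dec Bool._≟_

differences : ∀ {n} → Vertex n → Vertex n → ℕ
differences []      []      = 0
differences (x ∷ u) (y ∷ v) =
  if does (x Bool.≟ y) then differences u v else suc (differences u v)

differences-sym : ∀ {n} (u v : Vertex n) → differences u v ≡ differences v u
differences-sym []          []          = refl
differences-sym (false ∷ u) (false ∷ v) = differences-sym u v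
differences-sym (false ∷ u) (true  ∷ v) rewrite differences-sym u v = refl
differences-sym (true  ∷ u) (false ∷ v) rewrite differences-sym u v = refl
differences-sym (true  ∷ u) (true  ∷ v) = differences-sym u v

differences-self : ∀ {n} (v : Vertex n) → differences v v ≡ 0
differences-self []          = refl
differences-self (false ∷ v) = differences-self v
differences-self (true  ∷ v) = differences-self v

hypercube : (n : ℕ) → Graph (Vertex n)
hypercube n = record
  { Adj         = λ u v → differences u v ≡ 1
  ; adj?        = λ u v → differences u v ≟ 1
  ; symmetric   = λ {u} {v} uv → trans (differences-sym v u) uv
  ; irreflexive = λ {v} vv → 0≢1 (trans (sym (differences-self v)) vv)
  }
  where
  0≢1 : 0 ≢ 1
  0≢1 ()

vertices : (n : ℕ) → List (Vertex n)
vertices zero    = [] ∷ []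
vertices (suc n) = cartesianProductWith _∷_ (false ∷ true ∷ []) (vertices n)

vertices-complete : ∀ {n} (v : Vertex n) → v ∈ vertices n
vertices-complete []      = here refl
vertices-complete (x ∷ v) = ∈-cartesianProductWith⁺ _∷_ (bools x) (vertices-complete v)
  where
  bools : ∀ b → b ∈ (false ∷ true ∷ [])
  bools false = here refl
  bools true  = there (here refl)

vertices-unique : ∀ n → Unique (vertices n)
vertices-unique zero    = [] ∷ []
vertices-unique (suc n) =
  cartesianProductWith⁺ _∷_ ∷-injective (((λ ()) ∷ []) ∷ ([] ∷ [])) (vertices-unique n)

e : ∀ {n} → Graph (Vertex n) → ℕ
e {n} G = edgeCount G (vertices n)

-- IsSat n F s states that s = sat(Q_n, F).
record IsSat {W : Set} (n : ℕ) (F : Graph W) (s : ℕ) : Set₁ where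
  field
    attained : ∃[ G ] (Saturated _≟ᵛ_ (hypercube n) F G × e G ≡ s)
    minimum  : ∀ G → Saturated _≟ᵛ_ (hypercube n) F G → s ≤ e G

exponent : (m : ℕ) .{{_ : NonZero m}} → ℚ
exponent (suc zero)    = 1ℚ
exponent (suc (suc k)) = + 1 / (7 * 3 ^ k)
  where instance
    _ : NonZero (7 * 3 ^ k)
    _ = m*n≢0 7 (3 ^ k) {{_}} {{m^n≢0 3 k}}

-- s ≤ (c / n^a) · t for positive rationals c = C/D and a = p/q and n ≥ 1: multiply by D n^a and
-- raise both sides to the q-th power, which is monotone in both directions, to get
-- (D s)^q n^p ≤ (C t)^q. This avoids the possibly irrational n^a.
_≤[_/_^_]·_ : ℕ → ℚ → ℕ → ℚ → ℕ → Set
s ≤[ c / n ^ a ]· t =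
  (↧ₙ c * s) ^ ↧ₙ a * n ^ ∣ ↥ a ∣ ≤ (∣ ↥ c ∣ * t) ^ ↧ₙ a

{-# OPTIONS --safe #-}

-- Write m = M + 1 and Q_n = Q_a × Q_K, where Q_K is a product of 2M blocks Q_l with l = 2^r, M on
-- each of two sides. Every block carries a dominating code of density 1/l; a block of a vertex is
-- hit if it lies in the code, and otherwise flipping one coordinate, a fall, makes it hit. Edges of
-- Q_a are coloured by the weight parity of the lower end, so that no 4-cycle is monochromatic. The
-- layered graph has the falls on one side at points with no hit on the other side, and the
-- Q_a-edges of colour c over the points b with a hit on side c and none on the other side.
--
-- It contains no Q_m, while over a point without hits every Q_a-edge of colour c completes the Q_m
-- spanned by it and by the M falls of side c. Hence a saturated extension uses only Q_K-edges and
-- Q_a-edges over points with a hit, a proportion O(K/n + M/l) of all edges. Choosing l of order √n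
-- gives O(n^(-1/2)), which is better than all the required exponents for m > 1.
module Submission where

open import Defs
open import Data.Bool.Base using (Bool; true; false; not; _∧_; _xor_; T; if_then_else_)
import Data.Bool.Properties as Bool
open import Data.Empty using (⊥)
open import Data.Fin.Base using (Fin; zero; suc; combine)
import Data.Fin.Properties as Fin
open import Data.Fin.Properties using (any?; combine-injective; pigeonhole)
import Data.Integer.Base as ℤ
open import Data.List.Base using (List; []; _∷_; length; filter; cartesianProduct)
  renaming (map to mapᴸ; _++_ to _++ᴸ_)
open import Data.List.Membership.Propositional using (_∈_)
open import Data.List.Membership.Propositional.Properties using (∈-cartesianProduct⁺)
open import Data.List.Properties using (map-++; map-∘; ++-identityʳ)
open import Data.List.Relation.Unary.Any using (here; there)
open import Data.Nat.Base using (ℕ; zero; suc; _+_; _*_; _^_; _≤_; z≤n; s≤s; NonZero; >-nonZero)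
  renaming (_<_ to infix 4 _<ⁿ_)
open import Data.Nat.Coprimality using (1-coprimeTo) renaming (sym to coprime-sym)
open import Data.Nat.ListAction using (sum)
open import Data.Nat.ListAction.Properties using (sum-++)
import Data.Nat.Properties as ℕ
open import Data.Nat.Properties
  using (*-assoc; *-cancelʳ-<; *-cancelˡ-≤; *-comm; *-distribʳ-+; *-identityʳ; *-identityˡ;
         *-mono-≤; *-monoʳ-≤; *-monoˡ-≤; *-zeroʳ; +-comm; +-identityʳ; +-mono-<-≤; +-mono-≤;
         +-mono-≤-<; +-monoʳ-<; +-monoʳ-≤; <-≤-trans; <⇒≤; ^-distribˡ-+-*; ^-monoˡ-≤; _≤?_;
         m*n≡0⇒m≡0; m*n≢0; m<m*n; m^n≢0; module ≤-Reasoning; m≤m*n; m≤m+n; m≤n*m; m≤n+m;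
         m≤n⇒m≤1+n; m≤n⇒∃[o]m+o≡n; n<1+n; n≤0⇒n≡0; ≤-<-trans; ≤-antisym; ≤-refl; ≤-reflexive;
         ≤-trans; ≰⇒>)
open import Data.Nat.Solver using (module +-*-Solver)
open import Data.Product.Base using (_×_; _,_; proj₁; proj₂; ∃; ∃-syntax)
open import Data.Rational.Base using (ℚ; mkℚ; 0ℚ; _<_; *<*; _/_)
open import Data.Rational.Properties using (normalize-coprime)
open import Data.Sum.Base using (_⊎_; inj₁; inj₂; [_,_]) renaming (map to ⊎-map; map₁ to ⊎-map₁)
open import Data.Vec.Base using (Vec; []; _∷_; _++_; take; drop; lookup; replicate; zipWith)
open import Data.Vec.Properties
  using (take++drop≡id; ++-injective; zipWith-assoc; zipWith-comm; tabulate∘lookup; tabulate-cong)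
open import Function.Base using (_∘_; id)
open import Function.Definitions using (Injective)
open import Relation.Binary.PropositionalEquality
  using (_≡_; _≢_; _≗_; refl; sym; trans; cong; cong₂; subst; subst₂; module ≡-Reasoning)
open import Relation.Nullary.Decidable
  using (Dec; yes; no; isYes; map′; _×-dec_; _⊎-dec_; _→-dec_; ¬?; T?; fromWitness; toWitness;
         decidable-stable)
open import Relation.Nullary.Negation using (¬_; contradiction)

-- Exhaustive search and saturated extensions

-- The obstacle is to have many missing edges that each complete a copy while no copy is present. If
-- all `Q_a`-edges over points with a hit were used, copies could lie inside `Q_a`. The colouring
-- allows a vertex of a copy at most one `Q_a`-edge, but then each colour needs its own falls, hence
-- the two sides.
--
-- A `Q_a`-edge is paid for by a hit. At a lowest vertex of a copy with a hit on one side, at most M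
-- - 1 parts of that side can still fall, besides one `Q_a`-edge. Without hits no `Q_a`-edge is
-- present, and falls of opposite sides span no square. Either way only M directions are available,
-- one too few.
--
-- The exponent 1/2 comes from balancing the losses K/n, where K = 2Ml, and M/l. The case m = 1 is
-- the case M = 0 of the same construction, with no blocks at all.
--
-- `IsSat` asks for the minimum itself, and its existence has to be proved constructively, although
-- adjacency in `Graph` is an arbitrary decidable relation. This is why subgraphs of the cube are
-- replaced by Boolean tables, which can be searched.

Searchable : Set → Set₁
Searchable A = {P : A → Set} → (∀ x → Dec (P x)) → Dec (∃ P)

search-Bool : Searchable Bool
search-Bool P? = map′ [ (false ,_) , (true ,_) ]
  (λ { (false , p) → inj₁ p ; (true , p) → inj₂ p })
  (P? false ⊎-dec P? true)

search-Vertex : ∀ n → Searchable (Vertex n)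
search-Vertex zero    P? = map′ ([] ,_) (λ { ([] , p) → p }) (P? [])
search-Vertex (suc n) P? = map′
  [ (λ (v , p) → false ∷ v , p) , (λ (v , p) → true ∷ v , p) ]
  (λ { (false ∷ v , p) → inj₁ (v , p) ; (true ∷ v , p) → inj₂ (v , p) })
  (search-Vertex n (P? ∘ (false ∷_)) ⊎-dec search-Vertex n (P? ∘ (true ∷_)))

∀-vertex? : ∀ {n} {P : Vertex n → Set} → (∀ v → Dec (P v)) → Dec (∀ v → P v)
∀-vertex? {n} P? with search-Vertex n (¬? ∘ P?)
... | yes (v , ¬p) = no λ all → ¬p (all v)
... | no none      = yes λ v → decidable-stable (P? v) λ ¬p → none (v , ¬p)

glue : ∀ {n} {A : Set} → (Vertex n → A) → (Vertex n → A) → Vertex (suc n) → A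
glue f g (false ∷ v) = f v
glue f g (true  ∷ v) = g v

-- A function on `Vertex (suc n)` is a pair of functions on `Vertex n`, but without function
-- extensionality gluing the pair gives it back only pointwise. Hence `P` has to respect `_≗_`.
search-→ : ∀ n {A} → Searchable A → {P : (Vertex n → A) → Set} →
           (∀ {f g} → f ≗ g → P f → P g) → (∀ f → Dec (P f)) → Dec (∃ P)
search-→ zero    search resp P? = map′
  (λ (a , p) → (λ _ → a) , p)
  (λ (f , p) → f [] , resp (λ { [] → refl }) p)
  (search (λ a → P? (λ _ → a)))
search-→ (suc n) search {P} resp P? = map′
  (λ (f , g , p) → glue f g , p)
  (λ (h , p) → h ∘ (false ∷_) , h ∘ (true ∷_) ,
                resp (λ { (false ∷ _) → refl ; (true ∷ _) → refl }) p)
  (search-→ n search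
    (λ f≗f′ (g , p) → g , resp (λ { (false ∷ v) → f≗f′ v ; (true ∷ _) → refl }) p)
    (λ f → search-→ n search
      (λ g≗g′ → resp (λ { (false ∷ _) → refl ; (true ∷ v) → g≗g′ v }))
      (λ g → P? (glue f g))))

hasCopy-mono : ∀ {V W} {F : Graph W} {G H : Graph V} → G ⊆ H → HasCopy F G → HasCopy F H
hasCopy-mono G⊆H (f , inj , hom) = f , inj , λ xy → G⊆H (hom xy)

hasCopy? : ∀ {m n} (F : Graph (Vertex m)) (G : Graph (Vertex n)) → Dec (HasCopy F G)
hasCopy? {m} {n} F G = search-→ m (search-Vertex n)
  (λ {f} {g} f≗g (inj , hom) →
    (λ {x} {y} gx≡gy → inj (trans (f≗g x) (trans gx≡gy (sym (f≗g y))))) ,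
    (λ {x} {y} xy → subst₂ (Adj G) (f≗g x) (f≗g y) (hom xy)))
  (λ f → map′ (λ inj {x} {y} → inj x y) (λ inj x y → inj {x} {y})
           (∀-vertex? λ x → ∀-vertex? λ y → (f x ≟ᵛ f y) →-dec (x ≟ᵛ y))
         ×-dec
         map′ (λ hom {x} {y} → hom x y) (λ hom x y → hom {x} {y})
           (∀-vertex? λ x → ∀-vertex? λ y → Graph.adj? F x y →-dec Graph.adj? G (f x) (f y)))

addEdge-⊆ : ∀ {n} {G H : Graph (Vertex n)} {u v} {p : u ≢ v} → G ⊆ H → Adj H u v →
            addEdge _≟ᵛ_ G u v p ⊆ H
addEdge-⊆ {H = H} G⊆H uv (inj₁ xy)                   = G⊆H xy
addEdge-⊆ {H = H} G⊆H uv (inj₂ (inj₁ (refl , refl))) = uv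
addEdge-⊆ {H = H} G⊆H uv (inj₂ (inj₂ (refl , refl))) = Graph.symmetric H uv

IsSaturated : ∀ {m n} → Graph (Vertex m) → Graph (Vertex n) → Set
IsSaturated {n = n} = Saturated _≟ᵛ_ (hypercube n)

saturated-resp : ∀ {m n} {F : Graph (Vertex m)} {G H : Graph (Vertex n)} →
                 G ⊆ H → H ⊆ G → IsSaturated F G → IsSaturated F H
saturated-resp {F = F} {G} {H} G⊆H H⊆G sat = record
  { subgraph = λ uv → subgraph (H⊆G uv)
  ; free     = λ copy → free (hasCopy-mono {F = F} {G = H} {H = G} H⊆G copy)
  ; maximal  = λ u v uv ¬Huv →
      hasCopy-mono {F = F} {G = addEdge _≟ᵛ_ G u v (adj⇒≢ (hypercube _) uv)}
        {H = addEdge _≟ᵛ_ H u v (adj⇒≢ (hypercube _) uv)} (⊎-map₁ G⊆H)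
        (maximal u v uv (¬Huv ∘ G⊆H))
  }
  where open Saturated sat

saturated? : ∀ {m n} (F : Graph (Vertex m)) (G : Graph (Vertex n)) →
             G ⊆ hypercube n → Dec (IsSaturated F G)
saturated? {n = n} F G G⊆Q = map′
  (λ (free , max) → record { subgraph = G⊆Q ; free = free ; maximal = max })
  (λ sat → Saturated.free sat , Saturated.maximal sat)
  (¬? (hasCopy? F G) ×-dec ∀-vertex? λ u → ∀-vertex? λ v → maximalAt? u v)
  where
  maximalAt? : ∀ u v → Dec ((uv : Adj (hypercube n) u v) → ¬ Adj G u v →
                            HasCopy F (addEdge _≟ᵛ_ G u v (adj⇒≢ (hypercube n) uv)))
  maximalAt? u v with Graph.adj? (hypercube n) u v
  ... | no ¬uv = yes λ uv → contradiction uv ¬uv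
  ... | yes uv = map′ (λ f _ → f) (λ f → f uv)
    (¬? (Graph.adj? G u v) →-dec hasCopy? F (addEdge _≟ᵛ_ G u v (adj⇒≢ (hypercube n) uv)))

length-filter-mono : ∀ {A : Set} {P Q : A → Set} (P? : ∀ x → Dec (P x)) (Q? : ∀ x → Dec (Q x)) →
                     (∀ {x} → P x → Q x) → ∀ xs → length (filter P? xs) ≤ length (filter Q? xs)
length-filter-mono P? Q? P⇒Q []       = z≤n
length-filter-mono P? Q? P⇒Q (x ∷ xs) with P? x | Q? x
... | yes _ | yes _ = s≤s (length-filter-mono P? Q? P⇒Q xs)
... | yes p | no ¬q = contradiction (P⇒Q p) ¬q
... | no _  | yes _ = m≤n⇒m≤1+n (length-filter-mono P? Q? P⇒Q xs)
... | no _  | no _  = length-filter-mono P? Q? P⇒Q xs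

edgeCount-mono : ∀ {V} {G H : Graph V} → G ⊆ H → ∀ vs → edgeCount G vs ≤ edgeCount H vs
edgeCount-mono                 G⊆H []       = z≤n
edgeCount-mono {G = G} {H = H} G⊆H (v ∷ vs) =
  +-mono-≤ (length-filter-mono (Graph.adj? G v) (Graph.adj? H v) G⊆H vs)
           (edgeCount-mono {G = G} {H} G⊆H vs)

least : ∀ {P : ℕ → Set} → (∀ k → Dec (P k)) → ∀ {k} → P k →
        ∃[ s ] (P s × s ≤ k × (∀ {j} → P j → s ≤ j))
least P? {zero}  p = zero , p , z≤n , λ _ → z≤n
least {P} P? {suc k} p with P? zero
... | yes p₀ = zero , p₀ , z≤n , λ _ → z≤n
... | no ¬p₀ with s , q , s≤k , min ← least (P? ∘ suc) {k} p =
  suc s , q , s≤s s≤k , λ { {zero} p₀ → contradiction p₀ ¬p₀ ; {suc j} pⱼ → s≤s (min pⱼ) }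

-- Every table yields a graph: the two values of `φ` make it symmetric, and adjacency in the cube
-- makes it a subgraph of the cube. Searching the tables therefore reaches every subgraph of the
-- cube up to mutual inclusion.
tableGraph : ∀ n → (Vertex (n + n) → Bool) → Graph (Vertex n)
tableGraph n φ = record
  { Adj         = λ u v → Adj (hypercube n) u v × T (φ (u ++ v)) × T (φ (v ++ u))
  ; adj?        = λ u v → Graph.adj? (hypercube n) u v ×-dec (T? (φ (u ++ v)) ×-dec T? (φ (v ++ u)))
  ; symmetric   = λ {u} {v} (uv , p , q) → Graph.symmetric (hypercube n) {u} {v} uv , q , p
  ; irreflexive = λ {v} (vv , _) → Graph.irreflexive (hypercube n) {v} vv
  }

table : ∀ {n} → Graph (Vertex n) → Vertex (n + n) → Bool
table {n} G w = isYes (Graph.adj? G (take n w) (drop n w))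

take-++ : ∀ {A : Set} {k l} (u : Vec A k) (v : Vec A l) → take k (u ++ v) ≡ u
take-++ []      v = refl
take-++ (x ∷ u) v = cong (x ∷_) (take-++ u v)

drop-++ : ∀ {A : Set} {k l} (u : Vec A k) (v : Vec A l) → drop k (u ++ v) ≡ v
drop-++ []      v = refl
drop-++ (x ∷ u) v = drop-++ u v

table-++ : ∀ {n} (G : Graph (Vertex n)) u v → table G (u ++ v) ≡ isYes (Graph.adj? G u v)
table-++ G u v = cong₂ (λ x y → isYes (Graph.adj? G x y)) (take-++ u v) (drop-++ u v)

tableGraph-⊆ : ∀ {n} (G : Graph (Vertex n)) → tableGraph n (table G) ⊆ G
tableGraph-⊆ G {u} {v} (_ , uv , _) = toWitness (subst T (table-++ G u v) uv)

⊆-tableGraph : ∀ {n} (G : Graph (Vertex n)) → G ⊆ hypercube n → G ⊆ tableGraph n (table G)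
⊆-tableGraph G G⊆Q {u} {v} uv =
  G⊆Q uv , subst T (sym (table-++ G u v)) (fromWitness uv)
         , subst T (sym (table-++ G v u)) (fromWitness (Graph.symmetric G uv))

tableGraph-resp : ∀ n {φ ψ : Vertex (n + n) → Bool} → φ ≗ ψ → tableGraph n φ ⊆ tableGraph n ψ
tableGraph-resp n φ≗ψ {u} {v} (uv , p , q) =
  uv , subst T (φ≗ψ (u ++ v)) p , subst T (φ≗ψ (v ++ u)) q

e-cong : ∀ {n} {G H : Graph (Vertex n)} → G ⊆ H → H ⊆ G → e G ≡ e H
e-cong {n} {G} {H} G⊆H H⊆G = ≤-antisym
  (edgeCount-mono {G = G} {H} G⊆H (vertices n)) (edgeCount-mono {G = H} {G} H⊆G (vertices n))

-- The given graph shows that some edge number is attained, so that `least` has a bound to search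
-- below. Minimality extends from tables to all graphs because a saturated graph and its table have
-- the same edges.
sat-exists : ∀ {m n} (F : Graph (Vertex m)) (G : Graph (Vertex n)) → IsSaturated F G →
             ∃[ s ] (IsSat n F s × s ≤ e G)
sat-exists {n = n} F G satG =
  let s , (φ , sat , eφ≡s) , s≤eG , min = least Attained? (attained G satG)
  in s , record { attained = tableGraph n φ , sat , eφ≡s
                ; minimum  = λ H satH → min (attained H satH) } , s≤eG
  where
  Attained : ℕ → Set
  Attained j = ∃[ φ ] (IsSaturated F (tableGraph n φ) × e (tableGraph n φ) ≡ j)

  Attained? : ∀ j → Dec (Attained j)
  Attained? j = search-→ (n + n) search-Bool
    (λ {φ} {ψ} φ≗ψ (sat , eq) →
      let φ⊆ψ : tableGraph n φ ⊆ tableGraph n ψ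
          φ⊆ψ {u} {v} = tableGraph-resp n φ≗ψ {u} {v}
          ψ⊆φ : tableGraph n ψ ⊆ tableGraph n φ
          ψ⊆φ {u} {v} = tableGraph-resp n (sym ∘ φ≗ψ) {u} {v}
      in saturated-resp {G = tableGraph n φ} {tableGraph n ψ}
           (λ {u} {v} → φ⊆ψ {u} {v}) (λ {u} {v} → ψ⊆φ {u} {v}) sat ,
         trans (e-cong {G = tableGraph n ψ} {tableGraph n φ}
           (λ {u} {v} → ψ⊆φ {u} {v}) (λ {u} {v} → φ⊆ψ {u} {v})) eq)
    (λ φ → saturated? F (tableGraph n φ) proj₁ ×-dec (e (tableGraph n φ) ℕ.≟ j))

  attained : ∀ H → IsSaturated F H → Attained (e H)
  attained H sat = table H ,
    saturated-resp {G = H} {tableGraph n (table H)} ⊆table (λ {u} {v} → table⊆ {u} {v}) sat ,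
    e-cong {G = tableGraph n (table H)} {H} (λ {u} {v} → table⊆ {u} {v}) ⊆table
    where
    ⊆table : H ⊆ tableGraph n (table H)
    ⊆table = ⊆-tableGraph H (Saturated.subgraph sat)
    table⊆ : tableGraph n (table H) ⊆ H
    table⊆ {u} {v} = tableGraph-⊆ H {u} {v}

-- One greedy pass over all pairs suffices: copies persist when the graph grows, so a pair rejected
-- once would complete a copy at every later stage too.
saturate : ∀ {m n} (F : Graph (Vertex m)) (G : Graph (Vertex n)) →
           G ⊆ hypercube n → ¬ HasCopy F G → ∃[ H ] (G ⊆ H × IsSaturated F H)
saturate {n = n} F G₀ G₀⊆Q free₀ =
  let G , G₀⊆G , G⊆Q , free , max = extend (cartesianProduct (vertices n) (vertices n))
  in G , G₀⊆G , record
       { subgraph = G⊆Q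
       ; free     = free
       ; maximal  = λ u v →
           max (∈-cartesianProduct⁺ (vertices-complete u) (vertices-complete v))
       }
  where
  Q : Graph (Vertex n)
  Q = hypercube n

  extend : (L : List (Vertex n × Vertex n)) →
    ∃[ G ] (G₀ ⊆ G × G ⊆ Q × ¬ HasCopy F G ×
      (∀ {u v} → (u , v) ∈ L → (uv : Adj Q u v) → ¬ Adj G u v →
       HasCopy F (addEdge _≟ᵛ_ G u v (adj⇒≢ Q uv))))
  extend [] = G₀ , id , G₀⊆Q , free₀ , λ ()
  extend ((u , v) ∷ L) with G , G₀⊆G , G⊆Q , free , max ← extend L | Graph.adj? Q u v
  ... | no ¬uv = G , G₀⊆G , G⊆Q , free , λ
    { (here refl) uv → contradiction uv ¬uv ; (there i) → max i }
  ... | yes uv with hasCopy? F (addEdge _≟ᵛ_ G u v (adj⇒≢ Q uv))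
  ...   | yes copy = G , G₀⊆G , G⊆Q , free , λ
    { (here refl) _ _ → copy ; (there i) → max i }
  ...   | no ¬copy = G′ , (λ xy → inj₁ (G₀⊆G xy)) , addEdge-⊆ {G = G} {Q} {p = adj⇒≢ Q uv} G⊆Q uv , ¬copy , λ
    { (here refl) _ ¬uv → contradiction (inj₂ (inj₁ (refl , refl))) ¬uv
    ; {x} {y} (there i) xy ¬xy →
        hasCopy-mono {F = F} {G = addEdge _≟ᵛ_ G x y (adj⇒≢ Q xy)}
          {H = addEdge _≟ᵛ_ G′ x y (adj⇒≢ Q xy)} (⊎-map₁ inj₁) (max i xy (¬xy ∘ inj₁)) }
    where G′ = addEdge _≟ᵛ_ G u v (adj⇒≢ Q uv)

-- An edge of a saturated extension `H` of `G` that lies outside `B` would complete a copy with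
-- edges of `G`, and this copy would lie in `H`. So `H ⊆ B`, and `B` can be counted without knowing
-- `H`.
sat-≤ : ∀ {m n} (F : Graph (Vertex m)) (G B : Graph (Vertex n)) →
        G ⊆ hypercube n → ¬ HasCopy F G →
        (∀ {u v} (uv : Adj (hypercube n) u v) → ¬ Adj B u v →
         HasCopy F (addEdge _≟ᵛ_ G u v (adj⇒≢ (hypercube n) uv))) →
        ∃[ s ] (IsSat n F s × s ≤ e B)
sat-≤ {n = n} F G B G⊆Q free complete =
  let H , G⊆H , satH = saturate F G G⊆Q free
      s , isSat , s≤eH = sat-exists F H satH
      H⊆B : H ⊆ B
      H⊆B {u} {v} uv = decidable-stable (Graph.adj? B u v) λ ¬uv →
        let uv′ = Saturated.subgraph satH uv
            u≢v = adj⇒≢ (hypercube n) uv′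
        in Saturated.free satH (hasCopy-mono {F = F} {G = addEdge _≟ᵛ_ G u v u≢v} {H = H}
             (addEdge-⊆ {G = G} {H} {p = u≢v} G⊆H uv) (complete uv′ ¬uv))
  in s , isSat , ≤-trans s≤eH (edgeCount-mono {G = H} {B} H⊆B (vertices n))

-- Counting edges of subgraphs of the hypercube

differences≡0⇒≡ : ∀ {n} (u v : Vertex n) → differences u v ≡ 0 → u ≡ v
differences≡0⇒≡ []          []          _  = refl
differences≡0⇒≡ (false ∷ u) (false ∷ v) eq = cong (false ∷_) (differences≡0⇒≡ u v eq)
differences≡0⇒≡ (true  ∷ u) (true  ∷ v) eq = cong (true ∷_) (differences≡0⇒≡ u v eq)

Σᵛ : ∀ n → (Vertex n → ℕ) → ℕ
Σᵛ zero    g = g []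
Σᵛ (suc n) g = Σᵛ n (g ∘ (false ∷_)) + Σᵛ n (g ∘ (true ∷_))

Σᵛ-cong : ∀ n {f g : Vertex n → ℕ} → f ≗ g → Σᵛ n f ≡ Σᵛ n g
Σᵛ-cong zero    f≗g = f≗g []
Σᵛ-cong (suc n) f≗g = cong₂ _+_ (Σᵛ-cong n (f≗g ∘ (false ∷_))) (Σᵛ-cong n (f≗g ∘ (true ∷_)))

Σᵛ-mono : ∀ n {f g : Vertex n → ℕ} → (∀ v → f v ≤ g v) → Σᵛ n f ≤ Σᵛ n g
Σᵛ-mono zero    f≤g = f≤g []
Σᵛ-mono (suc n) f≤g = +-mono-≤ (Σᵛ-mono n (f≤g ∘ (false ∷_))) (Σᵛ-mono n (f≤g ∘ (true ∷_)))

Σᵛ-+ : ∀ n (f g : Vertex n → ℕ) → Σᵛ n (λ v → f v + g v) ≡ Σᵛ n f + Σᵛ n g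
Σᵛ-+ zero    f g = refl
Σᵛ-+ (suc n) f g
  rewrite Σᵛ-+ n (f ∘ (false ∷_)) (g ∘ (false ∷_)) | Σᵛ-+ n (f ∘ (true ∷_)) (g ∘ (true ∷_)) =
  solve 4 (λ a b c d → (a :+ b) :+ (c :+ d) := (a :+ c) :+ (b :+ d)) refl
    (Σᵛ n (f ∘ (false ∷_))) _ _ _
  where open +-*-Solver

Σᵛ-const : ∀ n c → Σᵛ n (λ _ → c) ≡ 2 ^ n * c
Σᵛ-const zero    c = sym (+-identityʳ c)
Σᵛ-const (suc n) c rewrite Σᵛ-const n c =
  solve 2 (λ p c → p :* c :+ p :* c := (con 2 :* p) :* c) refl (2 ^ n) c
  where open +-*-Solver

Σᵛ-*ʳ : ∀ n (f : Vertex n → ℕ) c → Σᵛ n (λ v → f v * c) ≡ Σᵛ n f * c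
Σᵛ-*ʳ zero    f c = refl
Σᵛ-*ʳ (suc n) f c = trans
  (cong₂ _+_ (Σᵛ-*ʳ n (f ∘ (false ∷_)) c) (Σᵛ-*ʳ n (f ∘ (true ∷_)) c))
  (sym (*-distribʳ-+ c (Σᵛ n (f ∘ (false ∷_))) (Σᵛ n (f ∘ (true ∷_)))))

Σᵛ-++ : ∀ k l (g : Vertex (k + l) → ℕ) → Σᵛ (k + l) g ≡ Σᵛ k (λ u → Σᵛ l (λ v → g (u ++ v)))
Σᵛ-++ zero    l g = refl
Σᵛ-++ (suc k) l g = cong₂ _+_ (Σᵛ-++ k l (g ∘ (false ∷_))) (Σᵛ-++ k l (g ∘ (true ∷_)))

Σᵛ-take : ∀ k l (g : Vertex k → ℕ) → Σᵛ (k + l) (g ∘ take k) ≡ 2 ^ l * Σᵛ k g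
Σᵛ-take k l g = begin
  Σᵛ (k + l) (g ∘ take k)                     ≡⟨ Σᵛ-++ k l _ ⟩
  Σᵛ k (λ u → Σᵛ l (λ v → g (take k (u ++ v)))) ≡⟨ Σᵛ-cong k (λ u → Σᵛ-cong l (λ v → cong g (take-++ u v))) ⟩
  Σᵛ k (λ u → Σᵛ l (λ v → g u))               ≡⟨ Σᵛ-cong k (λ u → Σᵛ-const l (g u)) ⟩
  Σᵛ k (λ u → 2 ^ l * g u)                    ≡⟨ Σᵛ-cong k (λ u → *-comm (2 ^ l) (g u)) ⟩
  Σᵛ k (λ u → g u * 2 ^ l)                    ≡⟨ Σᵛ-*ʳ k g (2 ^ l) ⟩
  Σᵛ k g * 2 ^ l                              ≡⟨ *-comm (Σᵛ k g) (2 ^ l) ⟩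
  2 ^ l * Σᵛ k g                              ∎
  where open ≡-Reasoning

Σᵛ-drop : ∀ k l (g : Vertex l → ℕ) → Σᵛ (k + l) (g ∘ drop k) ≡ 2 ^ k * Σᵛ l g
Σᵛ-drop k l g = begin
  Σᵛ (k + l) (g ∘ drop k)                     ≡⟨ Σᵛ-++ k l _ ⟩
  Σᵛ k (λ u → Σᵛ l (λ v → g (drop k (u ++ v)))) ≡⟨ Σᵛ-cong k (λ u → Σᵛ-cong l (λ v → cong g (drop-++ u v))) ⟩
  Σᵛ k (λ u → Σᵛ l g)                         ≡⟨ Σᵛ-const k _ ⟩
  2 ^ k * Σᵛ l g                              ∎
  where open ≡-Reasoning

Σᵛ-zero : ∀ n {g : Vertex n → ℕ} → (∀ v → g v ≡ 0) → Σᵛ n g ≡ 0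
Σᵛ-zero n g≗0 = trans (Σᵛ-cong n g≗0) (trans (Σᵛ-const n 0) (*-zeroʳ (2 ^ n)))

Σᵛ-single : ∀ {n} (x : Vertex n) {g : Vertex n → ℕ} → (∀ v → x ≢ v → g v ≡ 0) → Σᵛ n g ≡ g x
Σᵛ-single         []          off = refl
Σᵛ-single {suc n} (false ∷ x) {g} off = trans
  (cong₂ _+_ (Σᵛ-single x (λ v x≢v → off (false ∷ v) (λ { refl → x≢v refl })))
             (Σᵛ-zero n (λ v → off (true ∷ v) λ ())))
  (+-identityʳ (g (false ∷ x)))
Σᵛ-single {suc n} (true ∷ x) off = cong₂ _+_
  (Σᵛ-zero n (λ v → off (false ∷ v) λ ()))
  (Σᵛ-single x (λ v x≢v → off (true ∷ v) (λ { refl → x≢v refl })))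

sum-vertices : ∀ n (g : Vertex n → ℕ) → sum (mapᴸ g (vertices n)) ≡ Σᵛ n g
sum-vertices zero    g = +-identityʳ (g [])
sum-vertices (suc n) g = begin
  sum (mapᴸ g (mapᴸ (false ∷_) vs ++ᴸ (mapᴸ (true ∷_) vs ++ᴸ [])))
    ≡⟨ cong (λ ws → sum (mapᴸ g (mapᴸ (false ∷_) vs ++ᴸ ws))) (++-identityʳ _) ⟩
  sum (mapᴸ g (mapᴸ (false ∷_) vs ++ᴸ mapᴸ (true ∷_) vs))
    ≡⟨ cong sum (map-++ g (mapᴸ (false ∷_) vs) _) ⟩
  sum (mapᴸ g (mapᴸ (false ∷_) vs) ++ᴸ mapᴸ g (mapᴸ (true ∷_) vs))
    ≡⟨ sum-++ (mapᴸ g (mapᴸ (false ∷_) vs)) _ ⟩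
  sum (mapᴸ g (mapᴸ (false ∷_) vs)) + sum (mapᴸ g (mapᴸ (true ∷_) vs))
    ≡⟨ cong₂ (λ xs ys → sum xs + sum ys) (map-∘ vs) (map-∘ vs) ⟨
  sum (mapᴸ (g ∘ (false ∷_)) vs) + sum (mapᴸ (g ∘ (true ∷_)) vs)
    ≡⟨ cong₂ _+_ (sum-vertices n _) (sum-vertices n _) ⟩
  Σᵛ (suc n) g ∎
  where
  open ≡-Reasoning
  vs = vertices n

bit : Bool → ℕ
bit b = if b then 1 else 0

length-filter≡sum : ∀ {A : Set} {P : A → Set} (P? : ∀ x → Dec (P x)) xs →
                    length (filter P? xs) ≡ sum (mapᴸ (bit ∘ isYes ∘ P?) xs)
length-filter≡sum P? []       = refl
length-filter≡sum P? (x ∷ xs) with P? x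
... | yes _ = cong suc (length-filter≡sum P? xs)
... | no _  = length-filter≡sum P? xs

comap : ∀ {V W : Set} → (V → W) → Graph W → Graph V
comap f G = record
  { Adj         = λ u v → Adj G (f u) (f v)
  ; adj?        = λ u v → Graph.adj? G (f u) (f v)
  ; symmetric   = Graph.symmetric G
  ; irreflexive = Graph.irreflexive G
  }

degreeIn : ∀ {V} → Graph V → List V → V → ℕ
degreeIn G ys x = sum (mapᴸ (bit ∘ isYes ∘ Graph.adj? G x) ys)

edgeCount-map : ∀ {V W} (f : V → W) (G : Graph W) vs →
                edgeCount G (mapᴸ f vs) ≡ edgeCount (comap f G) vs
edgeCount-map f G []       = refl
edgeCount-map f G (v ∷ vs) = cong₂ _+_
  (trans (length-filter≡sum (Graph.adj? G (f v)) (mapᴸ f vs))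
    (trans (cong sum (sym (map-∘ vs))) (sym (length-filter≡sum (Graph.adj? G (f v) ∘ f) vs))))
  (edgeCount-map f G vs)

edgeCount-++ : ∀ {V} (G : Graph V) xs ys →
  edgeCount G (xs ++ᴸ ys) ≡ edgeCount G xs + edgeCount G ys + sum (mapᴸ (degreeIn G ys) xs)
edgeCount-++ G []       ys = sym (+-identityʳ (edgeCount G ys))
edgeCount-++ G (x ∷ xs) ys
  rewrite edgeCount-++ G xs ys
        | length-filter≡sum (Graph.adj? G x) (xs ++ᴸ ys)
        | length-filter≡sum (Graph.adj? G x) xs
        | map-++ (bit ∘ isYes ∘ Graph.adj? G x) xs ys
        | sum-++ (mapᴸ (bit ∘ isYes ∘ Graph.adj? G x) xs) (mapᴸ (bit ∘ isYes ∘ Graph.adj? G x) ys) =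
  solve 5 (λ a b c d f → (a :+ b) :+ (c :+ d :+ f) := (a :+ c) :+ d :+ (b :+ f)) refl
    (degreeIn G xs x) (degreeIn G ys x) (edgeCount G xs) (edgeCount G ys) (sum (mapᴸ (degreeIn G ys) xs))
  where open +-*-Solver

-- Splitting by the first coordinate, a pair from different halves can be adjacent only if the
-- remaining coordinates agree, since `G` is a subgraph of the cube.
e-suc : ∀ {n} (G : Graph (Vertex (suc n))) → G ⊆ hypercube (suc n) →
        e G ≡ e (comap (false ∷_) G) + e (comap (true ∷_) G)
            + Σᵛ n (λ x → bit (isYes (Graph.adj? G (false ∷ x) (true ∷ x))))
e-suc {n} G G⊆Q = begin
  edgeCount G (mapᴸ (false ∷_) vs ++ᴸ (mapᴸ (true ∷_) vs ++ᴸ []))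
    ≡⟨ cong (λ ws → edgeCount G (mapᴸ (false ∷_) vs ++ᴸ ws)) (++-identityʳ _) ⟩
  edgeCount G (mapᴸ (false ∷_) vs ++ᴸ mapᴸ (true ∷_) vs)
    ≡⟨ edgeCount-++ G (mapᴸ (false ∷_) vs) _ ⟩
  edgeCount G (mapᴸ (false ∷_) vs) + edgeCount G (mapᴸ (true ∷_) vs)
    + sum (mapᴸ (degreeIn G (mapᴸ (true ∷_) vs)) (mapᴸ (false ∷_) vs))
    ≡⟨ cong₂ _+_ (cong₂ _+_ (edgeCount-map (false ∷_) G vs) (edgeCount-map (true ∷_) G vs)) crossing ⟩
  e (comap (false ∷_) G) + e (comap (true ∷_) G)
    + Σᵛ n (λ x → bit (isYes (Graph.adj? G (false ∷ x) (true ∷ x)))) ∎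
  where
  open ≡-Reasoning
  vs = vertices n

  off : ∀ x w → x ≢ w → bit (isYes (Graph.adj? G (false ∷ x) (true ∷ w))) ≡ 0
  off x w x≢w with Graph.adj? G (false ∷ x) (true ∷ w)
  ... | yes xw = contradiction (differences≡0⇒≡ x w (ℕ.suc-injective (G⊆Q xw))) x≢w
  ... | no _   = refl

  crossing : sum (mapᴸ (degreeIn G (mapᴸ (true ∷_) vs)) (mapᴸ (false ∷_) vs)) ≡
             Σᵛ n (λ x → bit (isYes (Graph.adj? G (false ∷ x) (true ∷ x))))
  crossing = begin
    sum (mapᴸ (degreeIn G (mapᴸ (true ∷_) vs)) (mapᴸ (false ∷_) vs))
      ≡⟨ cong sum (map-∘ vs) ⟨
    sum (mapᴸ (degreeIn G (mapᴸ (true ∷_) vs) ∘ (false ∷_)) vs)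
      ≡⟨ sum-vertices n _ ⟩
    Σᵛ n (degreeIn G (mapᴸ (true ∷_) vs) ∘ (false ∷_))
      ≡⟨ Σᵛ-cong n (λ x → trans (cong sum (sym (map-∘ vs))) (trans (sum-vertices n _) (Σᵛ-single x (off x)))) ⟩
    Σᵛ n (λ x → bit (isYes (Graph.adj? G (false ∷ x) (true ∷ x)))) ∎

isYes-true : ∀ {P : Set} (P? : Dec P) → P → isYes P? ≡ true
isYes-true (yes _) _ = refl
isYes-true (no ¬p) p = contradiction p ¬p

e-hypercube-suc : ∀ n → e (hypercube (suc n)) ≡ e (hypercube n) + e (hypercube n) + 2 ^ n
e-hypercube-suc n = trans (e-suc (hypercube (suc n)) (λ uv → uv))
  (cong₂ _+_ (cong₂ _+_ (e-cong {G = comap (false ∷_) (hypercube (suc n))} {hypercube n} (λ uv → uv) (λ uv → uv))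
                        (e-cong {G = comap (true ∷_) (hypercube (suc n))} {hypercube n} (λ uv → uv) (λ uv → uv)))
    (trans (Σᵛ-cong n (λ x → cong bit (isYes-true (Graph.adj? (hypercube (suc n)) (false ∷ x) (true ∷ x))
                                        (cong suc (differences-self x)))))
           (trans (Σᵛ-const n 1) (*-identityʳ (2 ^ n)))))

2*e-hypercube : ∀ n → 2 * e (hypercube n) ≡ n * 2 ^ n
2*e-hypercube zero    = refl
2*e-hypercube (suc n) rewrite e-hypercube-suc n = begin
  2 * (q + q + p)       ≡⟨ solve 2 (λ q p → con 2 :* (q :+ q :+ p) := con 2 :* (con 2 :* q) :+ con 2 :* p) refl q p ⟩
  2 * (2 * q) + 2 * p   ≡⟨ cong (λ x → 2 * x + 2 * p) (2*e-hypercube n) ⟩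
  2 * (n * p) + 2 * p   ≡⟨ solve 2 (λ n p → con 2 :* (n :* p) :+ con 2 :* p := (con 1 :+ n) :* (con 2 :* p)) refl n p ⟩
  suc n * (2 * p)       ∎
  where
  open ≡-Reasoning
  open +-*-Solver
  q = e (hypercube n)
  p = 2 ^ n

-- This is the graph `B` of `sat-≤`. Edges along `Q_K` are all included; an edge along `Q_a` keeps
-- the `Q_K`-part and is included when `h` holds there.
exceptional : ∀ a {K} → (Vertex K → Bool) → Graph (Vertex (a + K))
exceptional a {K} h = record
  { Adj         = λ u v → Adj Q u v × (drop a u ≢ drop a v ⊎ (T (h (drop a u)) × T (h (drop a v))))
  ; adj?        = λ u v → Graph.adj? Q u v ×-dec
                    (¬? (drop a u ≟ᵛ drop a v) ⊎-dec (T? (h (drop a u)) ×-dec T? (h (drop a v))))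
  ; symmetric   = λ {u} {v} (uv , c) → Graph.symmetric Q {u} {v} uv ,
                    ⊎-map (λ ≢ ≡ → ≢ (sym ≡)) (λ (p , q) → q , p) c
  ; irreflexive = λ {v} (vv , _) → Graph.irreflexive Q {v} vv
  }
  where Q = hypercube (a + K)

-- Induction on `a`: the edges along a new coordinate of `Q_a` lie over points where `h` holds, with
-- `2 ^ a` of them over each such point, which matches the recursion of `e (hypercube a)`.
e-exceptional : ∀ a {K} (h : Vertex K → Bool) →
  e (exceptional a h) ≤ 2 ^ a * e (hypercube K) + e (hypercube a) * Σᵛ K (bit ∘ h)
e-exceptional zero {K} h = ≤-trans
  (edgeCount-mono {G = exceptional 0 h} {hypercube K} proj₁ (vertices K))
  (≤-reflexive (solve 1 (λ x → x := con 1 :* x :+ con 0) refl (e (hypercube K))))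
  where open +-*-Solver
e-exceptional (suc a) {K} h = begin
  e X
    ≡⟨ e-suc X proj₁ ⟩
  e (comap (false ∷_) X) + e (comap (true ∷_) X) + Σᵛ (a + K) cross
    ≡⟨ cong₂ (λ m n → m + n + Σᵛ (a + K) cross)
         (e-cong {G = comap (false ∷_) X} {exceptional a h} (λ uv → uv) (λ uv → uv))
         (e-cong {G = comap (true ∷_) X} {exceptional a h} (λ uv → uv) (λ uv → uv)) ⟩
  e (exceptional a h) + e (exceptional a h) + Σᵛ (a + K) cross
    ≤⟨ +-mono-≤ (+-mono-≤ (e-exceptional a h) (e-exceptional a h)) (Σᵛ-mono (a + K) crossing) ⟩
  bound + bound + Σᵛ (a + K) (bit ∘ h ∘ drop a)
    ≡⟨ cong (λ x → bound + bound + x) (Σᵛ-drop a K (bit ∘ h)) ⟩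
  bound + bound + 2 ^ a * Σᵛ K (bit ∘ h)
    ≡⟨ solve 4 (λ p k q s → (p :* k :+ q :* s) :+ (p :* k :+ q :* s) :+ p :* s
                          := (con 2 :* p) :* k :+ (q :+ q :+ p) :* s) refl
         (2 ^ a) (e (hypercube K)) (e (hypercube a)) (Σᵛ K (bit ∘ h)) ⟩
  2 ^ suc a * e (hypercube K) + (e (hypercube a) + e (hypercube a) + 2 ^ a) * Σᵛ K (bit ∘ h)
    ≡⟨ cong (λ q → 2 ^ suc a * e (hypercube K) + q * Σᵛ K (bit ∘ h)) (e-hypercube-suc a) ⟨
  2 ^ suc a * e (hypercube K) + e (hypercube (suc a)) * Σᵛ K (bit ∘ h) ∎
  where
  open ≤-Reasoning
  open +-*-Solver
  X = exceptional (suc a) h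
  bound = 2 ^ a * e (hypercube K) + e (hypercube a) * Σᵛ K (bit ∘ h)

  cross : Vertex (a + K) → ℕ
  cross x = bit (isYes (Graph.adj? X (false ∷ x) (true ∷ x)))

  crossing : ∀ x → cross x ≤ bit (h (drop a x))
  crossing x with Graph.adj? X (false ∷ x) (true ∷ x)
  ... | no _                    = z≤n
  ... | yes (_ , inj₁ ≢)        = contradiction refl ≢
  ... | yes (_ , inj₂ (t , _)) with true ← h (drop a x) = ≤-refl

-- Dominating codes

differences-++ : ∀ {k l} (u v : Vertex k) (w z : Vertex l) →
                 differences (u ++ w) (v ++ z) ≡ differences u v + differences w z
differences-++ []          []          w z = refl
differences-++ (false ∷ u) (false ∷ v) w z = differences-++ u v w z
differences-++ (false ∷ u) (true  ∷ v) w z = cong suc (differences-++ u v w z)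
differences-++ (true  ∷ u) (false ∷ v) w z = cong suc (differences-++ u v w z)
differences-++ (true  ∷ u) (true  ∷ v) w z = differences-++ u v w z

differences-split : ∀ k {l} (u v : Vertex (k + l)) →
  differences u v ≡ differences (take k u) (take k v) + differences (drop k u) (drop k v)
differences-split k u v = trans
  (sym (cong₂ differences (take++drop≡id k u) (take++drop≡id k v)))
  (differences-++ (take k u) (take k v) (drop k u) (drop k v))

parity : ∀ {n} → Vertex n → Bool
parity []      = false
parity (x ∷ v) = x xor parity v

parity-++ : ∀ {k l} (u : Vertex k) (v : Vertex l) → parity (u ++ v) ≡ parity u xor parity v
parity-++ []      v = refl
parity-++ (x ∷ u) v = trans (cong (x xor_) (parity-++ u v)) (sym (Bool.xor-assoc x (parity u) (parity v)))

infixl 6 _⊕_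
_⊕_ : ∀ {n} → Vertex n → Vertex n → Vertex n
_⊕_ = zipWith _xor_

_≡ᵇ_ : ∀ {n} → Vertex n → Vertex n → Bool
[]      ≡ᵇ []      = true
(x ∷ u) ≡ᵇ (y ∷ v) = not (x xor y) ∧ (u ≡ᵇ v)

-- Every `u` is its own inverse under `_⊕_`. In `count-syndrome` this turns a condition on a sum of
-- two syndromes into a condition on the second one.
≡ᵇ-⊕ : ∀ {n} (u v w : Vertex n) → ((u ⊕ v) ≡ᵇ w) ≡ (v ≡ᵇ (u ⊕ w))
≡ᵇ-⊕ []      []      []      = refl
≡ᵇ-⊕ (x ∷ u) (y ∷ v) (z ∷ w) = cong₂ (λ b c → not b ∧ c)
  (trans (cong (_xor z) (Bool.xor-comm x y)) (Bool.xor-assoc y x z)) (≡ᵇ-⊕ u v w)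

⊕-self : ∀ {n} (u : Vertex n) → ((u ⊕ u) ≡ᵇ replicate n false) ≡ true
⊕-self []          = refl
⊕-self (false ∷ u) = ⊕-self u
⊕-self (true  ∷ u) = ⊕-self u

⊕-assoc : ∀ {n} (u v w : Vertex n) → (u ⊕ v) ⊕ w ≡ u ⊕ (v ⊕ w)
⊕-assoc = zipWith-assoc Bool.xor-assoc

⊕-comm : ∀ {n} (u v : Vertex n) → u ⊕ v ≡ v ⊕ u
⊕-comm = zipWith-comm Bool.xor-comm

-- With this recursion a block of length `len (suc r)` splits into two of length `len r` by
-- computation; `2 ^ suc r` would leave a stray `+ 0`.
len : ℕ → ℕ
len zero    = 1
len (suc r) = len r + len r

len≡2^ : ∀ r → len r ≡ 2 ^ r
len≡2^ zero    = refl
len≡2^ (suc r) = cong₂ _+_ (len≡2^ r) (trans (len≡2^ r) (sym (+-identityʳ (2 ^ r))))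

-- The coordinates are indexed by {0,1}^r, the first half having leading bit 1;
-- the syndrome is the sum of the indices of the ones.
syndrome : ∀ r → Vertex (len r) → Vertex r
syndrome zero    v = []
syndrome (suc r) v =
  parity (take (len r) v) ∷ (syndrome r (take (len r) v) ⊕ syndrome r (drop (len r) v))

flipAt : ∀ r → Vertex r → Vertex (len r) → Vertex (len r)
flipAt zero    []          (x ∷ []) = not x ∷ []
flipAt (suc r) (true  ∷ p) v = flipAt r p (take (len r) v) ++ drop (len r) v
flipAt (suc r) (false ∷ p) v = take (len r) v ++ flipAt r p (drop (len r) v)

parity-flipAt : ∀ r p v → parity (flipAt r p v) ≡ not (parity v)
parity-flipAt zero    []          (false ∷ []) = refl
parity-flipAt zero    []          (true  ∷ []) = refl
parity-flipAt (suc r) (true ∷ p) v = begin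
  parity (flipAt r p x ++ z)         ≡⟨ parity-++ (flipAt r p x) z ⟩
  parity (flipAt r p x) xor parity z ≡⟨ cong (_xor parity z) (parity-flipAt r p x) ⟩
  not (parity x) xor parity z        ≡⟨ Bool.not-distribˡ-xor (parity x) (parity z) ⟨
  not (parity x xor parity z)        ≡⟨ cong not (parity-++ x z) ⟨
  not (parity (x ++ z))              ≡⟨ cong (not ∘ parity) (take++drop≡id (len r) v) ⟩
  not (parity v)                     ∎
  where
  open ≡-Reasoning
  x = take (len r) v
  z = drop (len r) v
parity-flipAt (suc r) (false ∷ p) v = begin
  parity (x ++ flipAt r p z)         ≡⟨ parity-++ x (flipAt r p z) ⟩
  parity x xor parity (flipAt r p z) ≡⟨ cong (parity x xor_) (parity-flipAt r p z) ⟩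
  parity x xor not (parity z)        ≡⟨ Bool.not-distribʳ-xor (parity x) (parity z) ⟨
  not (parity x xor parity z)        ≡⟨ cong not (parity-++ x z) ⟨
  not (parity (x ++ z))              ≡⟨ cong (not ∘ parity) (take++drop≡id (len r) v) ⟩
  not (parity v)                     ∎
  where
  open ≡-Reasoning
  x = take (len r) v
  z = drop (len r) v

syndrome-++ : ∀ r x z → syndrome (suc r) (x ++ z) ≡ parity x ∷ (syndrome r x ⊕ syndrome r z)
syndrome-++ r x z = cong₂ (λ x z → parity x ∷ (syndrome r x ⊕ syndrome r z)) (take-++ x z) (drop-++ x z)

-- The syndrome is linear, and a flip adds the index of the flipped coordinate. Flipping at the
-- index given by the syndrome therefore makes the syndrome zero.
syndrome-flipAt : ∀ r p v → syndrome r (flipAt r p v) ≡ syndrome r v ⊕ p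
syndrome-flipAt zero    []          v = refl
syndrome-flipAt (suc r) (true ∷ p) v = trans (syndrome-++ r (flipAt r p x) z)
  (cong₂ _∷_
    (trans (parity-flipAt r p x) (Bool.xor-comm true (parity x)))
    (begin
      syndrome r (flipAt r p x) ⊕ syndrome r z ≡⟨ cong (_⊕ syndrome r z) (syndrome-flipAt r p x) ⟩
      (syndrome r x ⊕ p) ⊕ syndrome r z        ≡⟨ ⊕-assoc (syndrome r x) p (syndrome r z) ⟩
      syndrome r x ⊕ (p ⊕ syndrome r z)        ≡⟨ cong (syndrome r x ⊕_) (⊕-comm p (syndrome r z)) ⟩
      syndrome r x ⊕ (syndrome r z ⊕ p)        ≡⟨ ⊕-assoc (syndrome r x) (syndrome r z) p ⟨
      (syndrome r x ⊕ syndrome r z) ⊕ p        ∎))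
  where
  open ≡-Reasoning
  x = take (len r) v
  z = drop (len r) v
syndrome-flipAt (suc r) (false ∷ p) v = trans (syndrome-++ r x (flipAt r p z))
  (cong₂ _∷_
    (sym (Bool.xor-identityʳ (parity x)))
    (trans (cong (syndrome r x ⊕_) (syndrome-flipAt r p z))
           (sym (⊕-assoc (syndrome r x) (syndrome r z) p))))
  where
  x = take (len r) v
  z = drop (len r) v

flipAt-adj : ∀ r p v → Adj (hypercube (len r)) v (flipAt r p v)
flipAt-adj zero    []          (false ∷ []) = refl
flipAt-adj zero    []          (true  ∷ []) = refl
flipAt-adj (suc r) (true ∷ p) v = begin
  differences v (flipAt r p x ++ z)                   ≡⟨ cong (λ v → differences v (flipAt r p x ++ z)) (take++drop≡id (len r) v) ⟨
  differences (x ++ z) (flipAt r p x ++ z)            ≡⟨ differences-++ x _ z z ⟩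
  differences x (flipAt r p x) + differences z z      ≡⟨ cong₂ _+_ (flipAt-adj r p x) (differences-self z) ⟩
  1                                                   ∎
  where
  open ≡-Reasoning
  x = take (len r) v
  z = drop (len r) v
flipAt-adj (suc r) (false ∷ p) v = begin
  differences v (x ++ flipAt r p z)                   ≡⟨ cong (λ v → differences v (x ++ flipAt r p z)) (take++drop≡id (len r) v) ⟨
  differences (x ++ z) (x ++ flipAt r p z)            ≡⟨ differences-++ x x z _ ⟩
  differences x x + differences z (flipAt r p z)      ≡⟨ cong₂ _+_ (differences-self x) (flipAt-adj r p z) ⟩
  1                                                   ∎
  where
  open ≡-Reasoning
  x = take (len r) v
  z = drop (len r) v

bit-∧ : ∀ b c → bit (b ∧ c) ≡ bit b * bit c
bit-∧ false c = refl
bit-∧ true  c = sym (+-identityʳ (bit c))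

count-parity : ∀ n c → Σᵛ (suc n) (λ v → bit (not (parity v xor c))) ≡ 2 ^ n
count-parity n c = begin
  Σᵛ n (λ v → bit (not (parity v xor c))) + Σᵛ n (λ v → bit (not (not (parity v) xor c)))
    ≡⟨ Σᵛ-+ n _ _ ⟨
  Σᵛ n (λ v → bit (not (parity v xor c)) + bit (not (not (parity v) xor c)))
    ≡⟨ Σᵛ-cong n (λ v → one (parity v) c) ⟩
  Σᵛ n (λ v → 1)
    ≡⟨ trans (Σᵛ-const n 1) (*-identityʳ (2 ^ n)) ⟩
  2 ^ n ∎
  where
  open ≡-Reasoning
  one : ∀ b c → bit (not (b xor c)) + bit (not (not b xor c)) ≡ 1
  one false false = refl
  one false true  = refl
  one true  false = refl
  one true  true  = refl

-- `count-parity` pairs vectors by their first coordinate and fails for the empty vector, so the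
-- block length must be exhibited as a successor.
len-suc : ∀ r → ∃[ k ] len r ≡ suc k
len-suc zero = 0 , refl
len-suc (suc r) with k , eq ← len-suc r = k + len r , cong (_+ len r) eq

count-parity′ : ∀ r c → Σᵛ (len r) (λ v → bit (not (parity v xor c))) * 2 ≡ 2 ^ len r
count-parity′ r c with k , eq ← len-suc r rewrite eq =
  trans (cong (_* 2) (count-parity k c)) (*-comm (2 ^ k) 2)

-- Syndromes are equidistributed. Half of the first halves `x` have the parity `c`; for each of them
-- the second half must have the syndrome `syndrome r x ⊕ p`, which has density `1 / 2 ^ r` by
-- induction. The target varies with `x`, so the claim is needed for every `p` and not only for
-- zero.
count-syndrome : ∀ r p → Σᵛ (len r) (λ v → bit (syndrome r v ≡ᵇ p)) * 2 ^ r ≡ 2 ^ len r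
count-syndrome zero    []      = refl
count-syndrome (suc r) (c ∷ p) = begin
  Σᵛ (n + n) (λ v → bit (syndrome (suc r) v ≡ᵇ (c ∷ p))) * (2 * d)
    ≡⟨ cong (_* (2 * d)) (Σᵛ-++ n n _) ⟩
  Σᵛ n (λ x → Σᵛ n (λ z → bit (syndrome (suc r) (x ++ z) ≡ᵇ (c ∷ p)))) * (2 * d)
    ≡⟨ cong (_* (2 * d)) (Σᵛ-cong n (λ x → trans (Σᵛ-cong n (pointwise x)) (Σᵛ-*ʳ n _ (bit (not (parity x xor c)))))) ⟩
  Σᵛ n (λ x → fibre x * bit (not (parity x xor c))) * (2 * d)
    ≡⟨ *-comm _ (2 * d) ⟩
  (2 * d) * Σᵛ n (λ x → fibre x * bit (not (parity x xor c)))
    ≡⟨ *-assoc 2 d _ ⟩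
  2 * (d * Σᵛ n (λ x → fibre x * bit (not (parity x xor c))))
    ≡⟨ cong (2 *_) (trans (*-comm d _) (sym (Σᵛ-*ʳ n _ d))) ⟩
  2 * Σᵛ n (λ x → fibre x * bit (not (parity x xor c)) * d)
    ≡⟨ cong (2 *_) (Σᵛ-cong n uniform) ⟩
  2 * Σᵛ n (λ x → bit (not (parity x xor c)) * 2 ^ n)
    ≡⟨ cong (2 *_) (Σᵛ-*ʳ n _ (2 ^ n)) ⟩
  2 * (Σᵛ n (λ x → bit (not (parity x xor c))) * 2 ^ n)
    ≡⟨ solve 2 (λ s q → con 2 :* (s :* q) := (s :* con 2) :* q) refl (Σᵛ n (λ x → bit (not (parity x xor c)))) (2 ^ n) ⟩
  Σᵛ n (λ x → bit (not (parity x xor c))) * 2 * 2 ^ n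
    ≡⟨ cong (_* 2 ^ n) (count-parity′ r c) ⟩
  2 ^ n * 2 ^ n
    ≡⟨ ^-distribˡ-+-* 2 n n ⟨
  2 ^ (n + n) ∎
  where
  open ≡-Reasoning
  open +-*-Solver
  n = len r
  d = 2 ^ r

  fibre : Vertex n → ℕ
  fibre x = Σᵛ n (λ z → bit (syndrome r z ≡ᵇ (syndrome r x ⊕ p)))

  pointwise : ∀ x z → bit (syndrome (suc r) (x ++ z) ≡ᵇ (c ∷ p)) ≡
                      bit (syndrome r z ≡ᵇ (syndrome r x ⊕ p)) * bit (not (parity x xor c))
  pointwise x z = begin
    bit (syndrome (suc r) (x ++ z) ≡ᵇ (c ∷ p))
      ≡⟨ cong (λ s → bit (s ≡ᵇ (c ∷ p))) (syndrome-++ r x z) ⟩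
    bit (not (parity x xor c) ∧ ((syndrome r x ⊕ syndrome r z) ≡ᵇ p))
      ≡⟨ bit-∧ (not (parity x xor c)) _ ⟩
    bit (not (parity x xor c)) * bit ((syndrome r x ⊕ syndrome r z) ≡ᵇ p)
      ≡⟨ cong (λ b → bit (not (parity x xor c)) * bit b) (≡ᵇ-⊕ (syndrome r x) (syndrome r z) p) ⟩
    bit (not (parity x xor c)) * bit (syndrome r z ≡ᵇ (syndrome r x ⊕ p))
      ≡⟨ *-comm (bit (not (parity x xor c))) _ ⟩
    bit (syndrome r z ≡ᵇ (syndrome r x ⊕ p)) * bit (not (parity x xor c)) ∎

  uniform : ∀ x → fibre x * bit (not (parity x xor c)) * d ≡ bit (not (parity x xor c)) * 2 ^ n
  uniform x = begin
    fibre x * b * d   ≡⟨ solve 3 (λ f b d → f :* b :* d := b :* (f :* d)) refl (fibre x) b d ⟩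
    b * (fibre x * d) ≡⟨ cong (b *_) (count-syndrome r (syndrome r x ⊕ p)) ⟩
    b * 2 ^ n         ∎
    where b = bit (not (parity x xor c))

-- All that the layered graph needs to know about the blocks. A fall may forget where in its block
-- it started, since several words are corrected to the same codeword. Two falls in different blocks
-- together retain every block, whence `fall-joint-injective`.
record Parts (I : Set) (K r : ℕ) : Set where
  field
    hit        : I → Vertex K → Bool
    fall       : I → Vertex K → Vertex K
    fall-adj   : ∀ t v → Adj (hypercube K) v (fall t v)
    hit-fall   : ∀ t v → hit t (fall t v) ≡ true
    hit-fall-≢ : ∀ {s t} v → s ≢ t → hit s (fall t v) ≡ hit s v
    fall-comm  : ∀ {s t} v → s ≢ t → fall s (fall t v) ≡ fall t (fall s v)
    fall-joint-injective : ∀ {s t v w} → s ≢ t →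
                           fall s v ≡ fall s w → fall t v ≡ fall t w → v ≡ w
    density    : ∀ t → Σᵛ K (bit ∘ hit t) * 2 ^ r ≡ 2 ^ K

parts : ∀ r P → Parts (Fin P) (P * len r) r
parts r zero    = record
  { hit = λ () ; fall = λ () ; fall-adj = λ () ; hit-fall = λ ()
  ; hit-fall-≢ = λ { {()} } ; fall-comm = λ { {()} } ; fall-joint-injective = λ { {()} }
  ; density = λ () }
parts r (suc P) = record
  { hit = hit ; fall = fall ; fall-adj = fall-adj ; hit-fall = hit-fall
  ; hit-fall-≢ = hit-fall-≢ ; fall-comm = fall-comm
  ; fall-joint-injective = fall-joint-injective ; density = density }
  where
  module Rest = Parts (parts r P)

  k l : ℕ
  k = len r
  l = P * len r

  code : Vertex k → Bool
  code x = syndrome r x ≡ᵇ replicate r false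

  -- A codeword is flipped too, at the coordinate of index zero, and stays in the code. So `fall`
  -- always moves by one edge and always ends at a hit.
  correct : Vertex k → Vertex k
  correct x = flipAt r (syndrome r x) x

  hit : Fin (suc P) → Vertex (k + l) → Bool
  hit zero    v = code (take k v)
  hit (suc t) v = Rest.hit t (drop k v)

  fall : Fin (suc P) → Vertex (k + l) → Vertex (k + l)
  fall zero    v = correct (take k v) ++ drop k v
  fall (suc t) v = take k v ++ Rest.fall t (drop k v)

  fall-adj : ∀ t v → differences v (fall t v) ≡ 1
  fall-adj zero v = begin
    differences v (fall zero v)
      ≡⟨ cong (λ u → differences u (fall zero v)) (take++drop≡id k v) ⟨
    differences (take k v ++ drop k v) (fall zero v)
      ≡⟨ differences-++ (take k v) _ _ _ ⟩
    differences (take k v) (correct (take k v)) + differences (drop k v) (drop k v)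
      ≡⟨ cong₂ _+_ (flipAt-adj r _ (take k v)) (differences-self (drop k v)) ⟩
    1 ∎
    where open ≡-Reasoning
  fall-adj (suc t) v = begin
    differences v (fall (suc t) v)
      ≡⟨ cong (λ u → differences u (fall (suc t) v)) (take++drop≡id k v) ⟨
    differences (take k v ++ drop k v) (fall (suc t) v)
      ≡⟨ differences-++ (take k v) _ _ _ ⟩
    differences (take k v) (take k v) + differences (drop k v) (Rest.fall t (drop k v))
      ≡⟨ cong₂ _+_ (differences-self (take k v)) (Rest.fall-adj t (drop k v)) ⟩
    1 ∎
    where open ≡-Reasoning

  hit-fall : ∀ t v → hit t (fall t v) ≡ true
  hit-fall zero v
    rewrite take-++ (correct (take k v)) (drop k v)
          | syndrome-flipAt r (syndrome r (take k v)) (take k v) = ⊕-self (syndrome r (take k v))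
  hit-fall (suc t) v
    rewrite drop-++ (take k v) (Rest.fall t (drop k v)) = Rest.hit-fall t (drop k v)

  hit-fall-≢ : ∀ {s t} v → s ≢ t → hit s (fall t v) ≡ hit s v
  hit-fall-≢ {zero}  {zero}  v s≢t = contradiction refl s≢t
  hit-fall-≢ {zero}  {suc t} v s≢t = cong code (take-++ (take k v) _)
  hit-fall-≢ {suc s} {zero}  v s≢t = cong (Rest.hit s) (drop-++ (correct (take k v)) _)
  hit-fall-≢ {suc s} {suc t} v s≢t =
    trans (cong (Rest.hit s) (drop-++ (take k v) _)) (Rest.hit-fall-≢ (drop k v) (s≢t ∘ cong suc))

  fall-comm : ∀ {s t} v → s ≢ t → fall s (fall t v) ≡ fall t (fall s v)
  fall-comm {zero}  {zero}  v s≢t = refl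
  fall-comm {zero}  {suc t} v s≢t
    rewrite take-++ (take k v) (Rest.fall t (drop k v)) | drop-++ (take k v) (Rest.fall t (drop k v))
          | take-++ (correct (take k v)) (drop k v) | drop-++ (correct (take k v)) (drop k v) = refl
  fall-comm {suc s} {zero}  v s≢t
    rewrite take-++ (take k v) (Rest.fall s (drop k v)) | drop-++ (take k v) (Rest.fall s (drop k v))
          | take-++ (correct (take k v)) (drop k v) | drop-++ (correct (take k v)) (drop k v) = refl
  fall-comm {suc s} {suc t} v s≢t
    rewrite take-++ (take k v) (Rest.fall s (drop k v)) | drop-++ (take k v) (Rest.fall s (drop k v))
          | take-++ (take k v) (Rest.fall t (drop k v)) | drop-++ (take k v) (Rest.fall t (drop k v)) =
    cong (take k v ++_) (Rest.fall-comm (drop k v) (s≢t ∘ cong suc))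

  glue-≡ : ∀ {v w : Vertex (k + l)} → take k v ≡ take k w → drop k v ≡ drop k w → v ≡ w
  glue-≡ {v} {w} p q = trans (sym (take++drop≡id k v)) (trans (cong₂ _++_ p q) (take++drop≡id k w))

  fall-joint-injective : ∀ {s t v w} → s ≢ t → fall s v ≡ fall s w → fall t v ≡ fall t w → v ≡ w
  fall-joint-injective {zero}  {zero}  s≢t p q = contradiction refl s≢t
  fall-joint-injective {zero}  {suc t} {v} {w} s≢t p q =
    glue-≡ (proj₁ (++-injective (take k v) (take k w) q))
           (proj₂ (++-injective (correct (take k v)) (correct (take k w)) p))
  fall-joint-injective {suc s} {zero}  {v} {w} s≢t p q =
    glue-≡ (proj₁ (++-injective (take k v) (take k w) p))
           (proj₂ (++-injective (correct (take k v)) (correct (take k w)) q))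
  fall-joint-injective {suc s} {suc t} {v} {w} s≢t p q =
    let p₁ , p₂ = ++-injective (take k v) (take k w) p
        _  , q₂ = ++-injective (take k v) (take k w) q
    in glue-≡ p₁ (Rest.fall-joint-injective (s≢t ∘ cong suc) p₂ q₂)

  density : ∀ t → Σᵛ (k + l) (bit ∘ hit t) * 2 ^ r ≡ 2 ^ (k + l)
  density zero = begin
    Σᵛ (k + l) (bit ∘ code ∘ take k) * 2 ^ r ≡⟨ cong (_* 2 ^ r) (Σᵛ-take k l (bit ∘ code)) ⟩
    2 ^ l * Σᵛ k (bit ∘ code) * 2 ^ r        ≡⟨ *-assoc (2 ^ l) _ _ ⟩
    2 ^ l * (Σᵛ k (bit ∘ code) * 2 ^ r)      ≡⟨ cong (2 ^ l *_) (count-syndrome r (replicate r false)) ⟩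
    2 ^ l * 2 ^ k                            ≡⟨ *-comm (2 ^ l) (2 ^ k) ⟩
    2 ^ k * 2 ^ l                            ≡⟨ ^-distribˡ-+-* 2 k l ⟨
    2 ^ (k + l)                              ∎
    where open ≡-Reasoning
  density (suc t) = begin
    Σᵛ (k + l) (bit ∘ Rest.hit t ∘ drop k) * 2 ^ r ≡⟨ cong (_* 2 ^ r) (Σᵛ-drop k l (bit ∘ Rest.hit t)) ⟩
    2 ^ k * Σᵛ l (bit ∘ Rest.hit t) * 2 ^ r        ≡⟨ *-assoc (2 ^ k) _ _ ⟩
    2 ^ k * (Σᵛ l (bit ∘ Rest.hit t) * 2 ^ r)      ≡⟨ cong (2 ^ k *_) (Rest.density t) ⟩
    2 ^ k * 2 ^ l                                  ≡⟨ ^-distribˡ-+-* 2 k l ⟨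
    2 ^ (k + l)                                    ∎
    where open ≡-Reasoning

reindex : ∀ {I J K r} (ι : I → J) → Injective _≡_ _≡_ ι → Parts J K r → Parts I K r
reindex ι inj P = record
  { hit = hit ∘ ι ; fall = fall ∘ ι ; fall-adj = fall-adj ∘ ι ; hit-fall = hit-fall ∘ ι
  ; hit-fall-≢ = λ v s≢t → hit-fall-≢ v (s≢t ∘ inj) ; fall-comm = λ v s≢t → fall-comm v (s≢t ∘ inj)
  ; fall-joint-injective = λ s≢t → fall-joint-injective (s≢t ∘ inj) ; density = density ∘ ι }
  where open Parts P

two-sided : ∀ r M → Parts (Bool × Fin M) ((2 * M) * len r) r
two-sided r M = reindex (λ (c , i) → combine (digit c) i)
  (λ { {c , i} {d , j} eq → let p , q = combine-injective (digit c) i (digit d) j eq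
                            in cong₂ _,_ (digit-injective c d p) q })
  (parts r (2 * M))
  where
  digit : Bool → Fin 2
  digit false = zero
  digit true  = suc zero

  digit-injective : ∀ c d → digit c ≡ digit d → c ≡ d
  digit-injective false false _ = refl
  digit-injective true  true  _ = refl

bit-isYes-≤ : ∀ {P : Set} {k} (P? : Dec P) → (P → 1 ≤ k) → bit (isYes P?) ≤ k
bit-isYes-≤ (yes p) f = f p
bit-isYes-≤ (no _)  f = z≤n

union-bound : ∀ {K D N} M (p : Fin M → Vertex K → Bool) →
  (∀ i → Σᵛ K (bit ∘ p i) * D ≤ N) →
  Σᵛ K (λ v → bit (isYes (any? λ i → p i v Bool.≟ true))) * D ≤ M * N
union-bound {K} {D} zero    p b = ≤-reflexive (cong (_* D) (Σᵛ-zero K (λ _ → refl)))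
union-bound {K} {D} {N} (suc M) p b = begin
  Σᵛ K (λ v → bit (isYes (any? λ i → p i v Bool.≟ true))) * D
    ≤⟨ *-monoˡ-≤ D (Σᵛ-mono K pointwise) ⟩
  Σᵛ K (λ v → bit (p zero v) + rest v) * D
    ≡⟨ cong (_* D) (Σᵛ-+ K _ _) ⟩
  (Σᵛ K (bit ∘ p zero) + Σᵛ K rest) * D
    ≡⟨ *-distribʳ-+ D (Σᵛ K (bit ∘ p zero)) _ ⟩
  Σᵛ K (bit ∘ p zero) * D + Σᵛ K rest * D
    ≤⟨ +-mono-≤ (b zero) (union-bound M (p ∘ suc) (b ∘ suc)) ⟩
  N + M * N ∎
  where
  open ≤-Reasoning
  rest : Vertex K → ℕ
  rest v = bit (isYes (any? λ i → p (suc i) v Bool.≟ true))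

  pointwise : ∀ v → bit (isYes (any? λ i → p i v Bool.≟ true)) ≤ bit (p zero v) + rest v
  pointwise v = bit-isYes-≤ (any? λ i → p i v Bool.≟ true) λ
    { (zero  , t) → ≤-trans (≤-reflexive (sym (cong bit t))) (m≤m+n _ _)
    ; (suc i , t) → ≤-trans
        (≤-reflexive (sym (cong bit (isYes-true (any? λ i → p (suc i) v Bool.≟ true) (i , t)))))
        (m≤n+m _ _) }

-- The layered graph

-- For adjacent u and v this is the parity of the weight of the lower end.
colour : ∀ {n} → Vertex n → Vertex n → Bool
colour []      []      = false
colour (x ∷ u) (y ∷ v) = (x ∧ y) xor colour u v

colour-sym : ∀ {n} (u v : Vertex n) → colour u v ≡ colour v u
colour-sym []      []      = refl
colour-sym (x ∷ u) (y ∷ v) = cong₂ _xor_ (Bool.∧-comm x y) (colour-sym u v)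

-- `colour u u` is the parity of the weight of `u`, which changes along every edge.
colour-self : ∀ {n} (u v : Vertex n) → differences u v ≡ 1 → colour u u ≡ not (colour v v)
colour-self []          []          ()
colour-self (false ∷ u) (false ∷ v) eq = colour-self u v eq
colour-self (true  ∷ u) (true  ∷ v) eq = cong not (colour-self u v eq)
colour-self (false ∷ u) (true  ∷ v) eq
  with refl ← differences≡0⇒≡ u v (ℕ.suc-injective eq) = sym (Bool.not-involutive _)
colour-self (true  ∷ u) (false ∷ v) eq
  with refl ← differences≡0⇒≡ u v (ℕ.suc-injective eq) = refl

tails≡ : ∀ {n} {u v : Vertex n} → suc (differences u v) ≡ 1 → u ≡ v
tails≡ {u = u} {v} eq = differences≡0⇒≡ u v (ℕ.suc-injective eq)

-- Opposite edges of a 4-cycle are parallel, and their lower ends differ by one coordinate.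
colour-opposite : ∀ {n} (u v w z : Vertex n) →
  differences u v ≡ 1 → differences u w ≡ 1 → differences v z ≡ 1 → differences w z ≡ 1 →
  v ≢ w → u ≢ z → colour u v ≡ not (colour w z)
colour-opposite [] [] [] [] ()
colour-opposite (false ∷ u) (false ∷ v) (false ∷ w) (false ∷ z) uv uw vz wz v≢w u≢z =
  colour-opposite u v w z uv uw vz wz (v≢w ∘ cong (false ∷_)) (u≢z ∘ cong (false ∷_))
colour-opposite (true ∷ u) (true ∷ v) (true ∷ w) (true ∷ z) uv uw vz wz v≢w u≢z =
  cong not (colour-opposite u v w z uv uw vz wz (v≢w ∘ cong (true ∷_)) (u≢z ∘ cong (true ∷_)))
colour-opposite (false ∷ u) (true ∷ v) (false ∷ w) (true ∷ z) uv uw vz wz v≢w u≢z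
  with refl ← tails≡ {u = u} {v} uv | refl ← tails≡ {u = w} {z} wz = colour-self u w uw
colour-opposite (true ∷ u) (false ∷ v) (true ∷ w) (false ∷ z) uv uw vz wz v≢w u≢z
  with refl ← tails≡ {u = u} {v} uv | refl ← tails≡ {u = w} {z} wz = colour-self u w uw
colour-opposite (false ∷ u) (false ∷ v) (true ∷ w) (true ∷ z) uv uw vz wz v≢w u≢z
  with refl ← tails≡ {u = u} {w} uw | refl ← tails≡ {u = v} {z} vz = sym (Bool.not-involutive _)
colour-opposite (true ∷ u) (true ∷ v) (false ∷ w) (false ∷ z) uv uw vz wz v≢w u≢z
  with refl ← tails≡ {u = u} {w} uw | refl ← tails≡ {u = v} {z} vz = refl
colour-opposite (false ∷ u) (false ∷ v) (false ∷ w) (true ∷ z) uv uw vz wz v≢w u≢z =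
  contradiction (cong (false ∷_) (trans (tails≡ {u = v} {z} vz) (sym (tails≡ {u = w} {z} wz)))) v≢w
colour-opposite (true ∷ u) (true ∷ v) (true ∷ w) (false ∷ z) uv uw vz wz v≢w u≢z =
  contradiction (cong (true ∷_) (trans (tails≡ {u = v} {z} vz) (sym (tails≡ {u = w} {z} wz)))) v≢w
colour-opposite (false ∷ u) (true ∷ v) (true ∷ w) (_ ∷ z) uv uw vz wz v≢w u≢z =
  contradiction (cong (true ∷_) (trans (sym (tails≡ {u = u} {v} uv)) (tails≡ {u = u} {w} uw))) v≢w
colour-opposite (true ∷ u) (false ∷ v) (false ∷ w) (_ ∷ z) uv uw vz wz v≢w u≢z =
  contradiction (cong (false ∷_) (trans (sym (tails≡ {u = u} {v} uv)) (tails≡ {u = u} {w} uw))) v≢w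
colour-opposite (false ∷ u) (false ∷ v) (true ∷ w) (false ∷ z) uv uw vz wz v≢w u≢z =
  contradiction (cong (false ∷_) (trans (tails≡ {u = u} {w} uw) (tails≡ {u = w} {z} wz))) u≢z
colour-opposite (true ∷ u) (true ∷ v) (false ∷ w) (true ∷ z) uv uw vz wz v≢w u≢z =
  contradiction (cong (true ∷_) (trans (tails≡ {u = u} {w} uw) (tails≡ {u = w} {z} wz))) u≢z
colour-opposite (false ∷ u) (true ∷ v) (false ∷ w) (false ∷ z) uv uw vz wz v≢w u≢z =
  contradiction (cong (false ∷_) (trans (tails≡ {u = u} {v} uv) (tails≡ {u = v} {z} vz))) u≢z
colour-opposite (true ∷ u) (false ∷ v) (true ∷ w) (true ∷ z) uv uw vz wz v≢w u≢z =
  contradiction (cong (true ∷_) (trans (tails≡ {u = u} {v} uv) (tails≡ {u = v} {z} vz))) u≢z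

toggle : ∀ {n} → Fin n → Vertex n → Vertex n
toggle zero    (x ∷ v) = not x ∷ v
toggle (suc i) (x ∷ v) = x ∷ toggle i v

toggle-adj : ∀ {n} (i : Fin n) v → differences v (toggle i v) ≡ 1
toggle-adj zero    (false ∷ v) = cong suc (differences-self v)
toggle-adj zero    (true  ∷ v) = cong suc (differences-self v)
toggle-adj (suc i) (false ∷ v) = toggle-adj i v
toggle-adj (suc i) (true  ∷ v) = toggle-adj i v

toggle-comm : ∀ {n} (i j : Fin n) v → i ≢ j → toggle i (toggle j v) ≡ toggle j (toggle i v)
toggle-comm zero    zero    v       i≢j = refl
toggle-comm zero    (suc j) (x ∷ v) i≢j = refl
toggle-comm (suc i) zero    (x ∷ v) i≢j = refl
toggle-comm (suc i) (suc j) (x ∷ v) i≢j = cong (x ∷_) (toggle-comm i j v (i≢j ∘ cong suc))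

toggle-injective : ∀ {n} (i j : Fin n) v → toggle i v ≡ toggle j v → i ≡ j
toggle-injective zero    zero    v           eq = refl
toggle-injective zero    (suc j) (false ∷ v) ()
toggle-injective zero    (suc j) (true  ∷ v) ()
toggle-injective (suc i) zero    (false ∷ v) ()
toggle-injective (suc i) zero    (true  ∷ v) ()
toggle-injective (suc i) (suc j) (x ∷ v)     eq =
  cong suc (toggle-injective i j v (cong (drop 1) eq))

toggle-involutive : ∀ {n} (i : Fin n) v → toggle i (toggle i v) ≡ v
toggle-involutive zero    (x ∷ v) = cong (_∷ v) (Bool.not-involutive x)
toggle-involutive (suc i) (x ∷ v) = cong (x ∷_) (toggle-involutive i v)

count : ∀ {n} → (Fin n → Bool) → ℕ
count {zero}  p = 0
count {suc n} p = bit (p zero) + count (p ∘ suc)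

count-cong : ∀ {n} {p q : Fin n → Bool} → p ≗ q → count p ≡ count q
count-cong {zero}  p≗q = refl
count-cong {suc n} p≗q = cong₂ (λ b k → bit b + k) (p≗q zero) (count-cong (p≗q ∘ suc))

count-< : ∀ {n} {p q : Fin n → Bool} i → p i ≡ false → q i ≡ true → (∀ j → j ≢ i → p j ≡ q j) →
          count p <ⁿ count q
count-< zero    pᵢ qᵢ off rewrite pᵢ | qᵢ =
  s≤s (≤-reflexive (count-cong (λ j → off (suc j) λ ())))
count-< {p = p} {q} (suc i) pᵢ qᵢ off rewrite off zero (λ ()) =
  +-monoʳ-< (bit (q zero)) (count-< i pᵢ qᵢ (λ j j≢i → off (suc j) (j≢i ∘ Fin.suc-injective)))

lookup-ext : ∀ {n} (u v : Vertex n) → (∀ i → lookup u i ≡ lookup v i) → u ≡ v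
lookup-ext u v eq = trans (sym (tabulate∘lookup u)) (trans (tabulate-cong eq) (tabulate∘lookup v))

not≢ : ∀ b → not b ≢ b
not≢ b eq = Bool.not-¬ refl (sym eq)

module Layered {K r M : ℕ} (P : Parts (Bool × Fin M) K r) (a : ℕ) where
  open Parts P

  Hit : Bool → Vertex K → Set
  Hit c b = ∃[ i ] hit (c , i) b ≡ true

  Hit? : ∀ c b → Dec (Hit c b)
  Hit? c b = any? λ i → hit (c , i) b Bool.≟ true

  Point : Set
  Point = Vertex a × Vertex K

  Flat : Point → Point → Set
  Flat (x , b) (y , d) =
    b ≡ d × differences x y ≡ 1 × Hit (colour x y) b × ¬ Hit (not (colour x y)) b

  -- At a point without hits falls of both sides start. The first fall produces a hit on its side
  -- and thereby blocks all falls of the other side.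
  Fall : Point → Point → Set
  Fall (x , b) (y , d) =
    x ≡ y × ∃[ c ] ∃[ i ] (hit (c , i) b ≡ false × d ≡ fall (c , i) b × ¬ Hit (not c) b)

  Edge : Point → Point → Set
  Edge p q = Flat p q ⊎ (Fall p q ⊎ Fall q p)

  Flat? : ∀ p q → Dec (Flat p q)
  Flat? (x , b) (y , d) = (b ≟ᵛ d) ×-dec ((differences x y ℕ.≟ 1) ×-dec
    (Hit? (colour x y) b ×-dec ¬? (Hit? (not (colour x y)) b)))

  Fall? : ∀ p q → Dec (Fall p q)
  Fall? (x , b) (y , d) = (x ≟ᵛ y) ×-dec search-Bool λ c → any? λ i →
    (hit (c , i) b Bool.≟ false) ×-dec ((d ≟ᵛ fall (c , i) b) ×-dec ¬? (Hit? (not c) b))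

  Flat-sym : ∀ {p q} → Flat p q → Flat q p
  Flat-sym {x , b} {y , d} (refl , xy , h , ¬h) rewrite colour-sym x y =
    refl , trans (differences-sym y x) xy , h , ¬h

  Edge-sym : ∀ {p q} → Edge p q → Edge q p
  Edge-sym {p} {q} (inj₁ pq)        = inj₁ (Flat-sym {p} {q} pq)
  Edge-sym         (inj₂ (inj₁ pq)) = inj₂ (inj₂ pq)
  Edge-sym         (inj₂ (inj₂ qp)) = inj₂ (inj₁ qp)

  fall≢ : ∀ t b → b ≢ fall t b
  fall≢ t b eq = adj⇒≢ (hypercube K) {u = b} {fall t b} (fall-adj t b) eq

  Fall⇒≢ : ∀ {p q} → Fall p q → proj₂ p ≢ proj₂ q
  Fall⇒≢ {x , b} {y , d} (_ , c , i , _ , eq , _) b≡d = fall≢ (c , i) b (trans b≡d eq)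

  Edge-irrefl : ∀ {p} → ¬ Edge p p
  Edge-irrefl {x , b} (inj₁ (_ , xx , _)) with () ← trans (sym (differences-self x)) xx
  Edge-irrefl {p} (inj₂ (inj₁ pp)) = Fall⇒≢ {p} {p} pp refl
  Edge-irrefl {p} (inj₂ (inj₂ pp)) = Fall⇒≢ {p} {p} pp refl

  split : Vertex (a + K) → Point
  split u = take a u , drop a u

  split-injective : ∀ {u v} → split u ≡ split v → u ≡ v
  split-injective {u} {v} eq = trans (sym (take++drop≡id a u))
    (trans (cong (λ (x , b) → x ++ b) eq) (take++drop≡id a v))

  split-++ : ∀ x b → split (x ++ b) ≡ (x , b)
  split-++ x b = cong₂ _,_ (take-++ x b) (drop-++ x b)

  -- Edges are defined on pairs and pulled back along `split`, so that arguments about them speak of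
  -- components and not of `take` and `drop`.
  layered : Graph (Vertex (a + K))
  layered = comap split record
    { Adj = Edge ; adj? = λ p q → Flat? p q ⊎-dec (Fall? p q ⊎-dec Fall? q p)
    ; symmetric = λ {p} {q} → Edge-sym {p} {q} ; irreflexive = λ {p} → Edge-irrefl {p} }

  Fall⇒adj : ∀ {u v} → Fall (split u) (split v) → differences u v ≡ 1
  Fall⇒adj {u} {v} (x≡y , c , i , _ , eq , _) = begin
    differences u v
      ≡⟨ differences-split a u v ⟩
    differences (take a u) (take a v) + differences (drop a u) (drop a v)
      ≡⟨ cong₂ (λ x d → differences (take a u) x + differences (drop a u) d) (sym x≡y) eq ⟩
    differences (take a u) (take a u) + differences (drop a u) (fall (c , i) (drop a u))
      ≡⟨ cong₂ _+_ (differences-self (take a u)) (fall-adj (c , i) (drop a u)) ⟩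
    1 ∎
    where open ≡-Reasoning

  layered⊆hypercube : layered ⊆ hypercube (a + K)
  layered⊆hypercube {u} {v} (inj₁ (b≡d , xy , _)) = begin
    differences u v
      ≡⟨ differences-split a u v ⟩
    differences (take a u) (take a v) + differences (drop a u) (drop a v)
      ≡⟨ cong₂ _+_ xy (trans (cong (differences (drop a u)) (sym b≡d)) (differences-self (drop a u))) ⟩
    1 ∎
    where open ≡-Reasoning
  layered⊆hypercube {u} {v} (inj₂ (inj₁ uv)) = Fall⇒adj {u} {v} uv
  layered⊆hypercube {u} {v} (inj₂ (inj₂ vu)) = trans (differences-sym u v) (Fall⇒adj {v} {u} vu)

  -- Squares that cannot occur in a copy

  ¬Hit-fall : ∀ {c i b} → ¬ Hit (not c) b → ¬ Hit (not c) (fall (c , i) b)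
  ¬Hit-fall {c} {i} {b} ¬h (j , h) =
    ¬h (j , trans (sym (hit-fall-≢ b (λ eq → not≢ c (cong proj₁ eq)))) h)

  Flat-colour : ∀ {x y b d} c → Hit c b → ¬ Hit (not c) b → Flat (x , b) (y , d) → colour x y ≡ c
  Flat-colour {x} {y} c h ¬h (_ , _ , h′ , _) with colour x y Bool.≟ c
  ... | yes eq = eq
  ... | no neq = contradiction (subst (λ c′ → Hit c′ _) (Bool.¬-not neq) h′) ¬h

  Vertical : Point → Point → Set
  Vertical p q = Fall p q ⊎ Fall q p

  Vertical⇒≡ : ∀ {p q} → Vertical p q → proj₁ p ≡ proj₁ q
  Vertical⇒≡ (inj₁ (eq , _)) = eq
  Vertical⇒≡ (inj₂ (eq , _)) = sym eq

  Vertical⇒≢ : ∀ {p q} → Vertical p q → proj₂ p ≢ proj₂ q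
  Vertical⇒≢ {p} {q} (inj₁ pq) = Fall⇒≢ {p} {q} pq
  Vertical⇒≢ {p} {q} (inj₂ qp) = Fall⇒≢ {q} {p} qp ∘ sym

  Flat-¬≡ : ∀ {p q} → Flat p q → proj₁ p ≢ proj₁ q
  Flat-¬≡ {x , _} {y , _} (_ , xy , _) = adj⇒≢ (hypercube a) {u = x} {y} xy

  -- If the other two edges are flat too, the square is a 4-cycle over one point; the hits there
  -- allow only one colour, while opposite edges have different colours. If exactly one of them is
  -- flat, they disagree on the `Q_K`-part of `s`. If both are vertical, `q₁` and `q₂` coincide.
  no-flat-square : ∀ {p q₁ q₂ s} → Flat p q₁ → Flat p q₂ → Edge q₁ s → Edge q₂ s →
                   q₁ ≢ q₂ → p ≢ s → ⊥
  no-flat-square {x , b} {x₁ , _} {x₂ , _} {x₃ , d} (refl , xx₁ , h , ¬h) (refl , xx₂ , _)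
    (inj₁ (refl , x₁x₃ , _)) (inj₁ flat@(_ , x₂x₃ , _)) q₁≢q₂ p≢s =
    not≢ (colour x x₁) (sym (trans
      (colour-opposite x x₁ x₂ x₃ xx₁ xx₂ x₁x₃ x₂x₃
        (q₁≢q₂ ∘ cong (_, b)) (p≢s ∘ cong (_, b)))
      (cong not (Flat-colour {x₂} {x₃} {b} {b} (colour x x₁) h ¬h flat))))
  no-flat-square {q₂ = q₂} {s} (refl , _) (refl , _) (inj₁ (refl , _)) (inj₂ vert) _ _ =
    Vertical⇒≢ {q₂} {s} vert refl
  no-flat-square {q₁ = q₁} {s = s} (refl , _) (refl , _) (inj₂ vert) (inj₁ (refl , _)) _ _ =
    Vertical⇒≢ {q₁} {s} vert refl
  no-flat-square {q₁ = q₁} {q₂} {s} (refl , _) (refl , _) (inj₂ vert₁) (inj₂ vert₂) q₁≢q₂ _ =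
    q₁≢q₂ (cong (_, proj₂ q₁) (trans (Vertical⇒≡ {q₁} {s} vert₁) (sym (Vertical⇒≡ {q₂} {s} vert₂))))

  -- A fall of side `c′` cannot start at `p`, because of the hit on side `c`, and cannot end at `p`,
  -- because it would leave a hit on side `c′`. So the edge is a fall of side `c`, which does not
  -- affect the other side. The equation for `c′` absorbs the double negation when the sides are
  -- exchanged.
  Vertical-¬Hit : ∀ {p q c c′} → c′ ≡ not c → Hit c (proj₂ p) → ¬ Hit c′ (proj₂ p) →
                  Vertical p q → ¬ Hit c′ (proj₂ q)
  Vertical-¬Hit {c = c} refl h ¬h (inj₁ (_ , c₁ , k , _ , refl , ¬h₁)) with c₁ Bool.≟ c
  ... | yes refl = ¬Hit-fall {c} {k} ¬h
  ... | no neq   = contradiction (subst (λ c → Hit c _) (Bool.¬-not (neq ∘ sym)) h) ¬h₁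
  Vertical-¬Hit {q = _ , d} {c = c} refl h ¬h (inj₂ (_ , c₁ , k , _ , refl , ¬h₁)) with c₁ Bool.≟ c
  ... | yes refl = ¬h₁
  ... | no neq   = contradiction
    (k , subst (λ c → hit (c , k) (fall (c₁ , k) d) ≡ true) (Bool.¬-not neq) (hit-fall (c₁ , k) d)) ¬h

  -- As `s` has no hits, no fall ends there, so the edge is a fall from `s` to `d`. The part it
  -- falls in is hit at `d`, and `(c , t)` is the only such part, as `b` has no hits either.
  same-fall : ∀ {c t d b} → ¬ Hit (not c) b → ¬ Hit c b →
              proj₂ d ≡ fall (c , t) b → ∀ {s} →
              ¬ Hit (not c) (proj₂ s) → ¬ Hit c (proj₂ s) →
              Vertical d s → proj₂ d ≡ fall (c , t) (proj₂ s)
  same-fall {c} {t} {_ , d} {b} ¬n ¬h eq {_ , s} ¬n′ ¬h′ (inj₁ (_ , c₁ , k , _ , refl , _))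
    with c₁ Bool.≟ c
  ... | yes refl = contradiction (k , hit-fall (c₁ , k) d) ¬h′
  ... | no neq   = contradiction
    (k , subst (λ c → hit (c , k) s ≡ true) (Bool.¬-not neq) (hit-fall (c₁ , k) d)) ¬n′
  same-fall {c} {t} {_ , d} {b} ¬n ¬h eq {_ , s} ¬n′ ¬h′ (inj₂ (_ , c₁ , k , _ , eq′ , _))
    with (c₁ Bool.≟ c) ×-dec (k Fin.≟ t)
  ... | yes (refl , refl) = eq′
  ... | no neq with c₁ Bool.≟ c
  ...   | yes refl = contradiction (k , trans (sym (hit-fall-≢ b λ { refl → neq (refl , refl) }))
                       (trans (cong (hit (c₁ , k)) (trans (sym eq) eq′)) (hit-fall (c₁ , k) s))) ¬h
  ...   | no c₁≢c  = contradiction (k , subst (λ c → hit (c , k) b ≡ true) (Bool.¬-not c₁≢c)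
                       (trans (sym (hit-fall-≢ b λ { refl → neq (refl , refl) }))
                       (trans (cong (hit (c₁ , k)) (trans (sym eq) eq′)) (hit-fall (c₁ , k) s)))) ¬n

  -- When both edges to `s` are vertical, `s` has no hit on the side missed by `q₁` nor on the side
  -- missed by `q₂`, hence none at all. Then `q₁` and `q₂` arise from `s` by the same two falls as
  -- from `b`, and falls in two different blocks determine the point. Flat edges are excluded by
  -- comparing components: `q₁` and `q₂` have the same `Q_a`-part but different hits.
  no-fall-square : ∀ {x b q₁ q₂ s} c i j → ¬ Hit c b → ¬ Hit (not c) b →
    q₁ ≡ (x , fall (c , i) b) → q₂ ≡ (x , fall (not c , j) b) →
    Edge q₁ s → Edge q₂ s → (x , b) ≢ s → ⊥
  no-fall-square {x} {b} {s = s} c i j ¬h ¬n refl refl e₁ e₂ p≢s = go e₁ e₂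
    where
    q₁ q₂ : Point
    q₁ = x , fall (c , i) b
    q₂ = x , fall (not c , j) b

    h₁ : Hit c (proj₂ q₁)
    h₁ = i , hit-fall (c , i) b

    ¬n₁ : ¬ Hit (not c) (proj₂ q₁)
    ¬n₁ = ¬Hit-fall {c} {i} ¬n

    n₂ : Hit (not c) (proj₂ q₂)
    n₂ = j , hit-fall (not c , j) b

    ¬nn : ¬ Hit (not (not c)) b
    ¬nn = ¬h ∘ subst (λ c → Hit c b) (Bool.not-involutive c)

    ¬h₂ : ¬ Hit c (proj₂ q₂)
    ¬h₂ = ¬Hit-fall {not c} {j} ¬nn ∘ subst (λ c → Hit c (proj₂ q₂)) (sym (Bool.not-involutive c))

    go : Edge q₁ s → Edge q₂ s → ⊥
    go (inj₁ (refl , _)) (inj₁ (eq , _)) = ¬h₂ (subst (Hit c) (sym eq) h₁)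
    go (inj₁ flat)       (inj₂ vert)     =
      Flat-¬≡ {q₁} {s} flat (Vertical⇒≡ {q₂} {s} vert)
    go (inj₂ vert)       (inj₁ flat)     =
      Flat-¬≡ {q₂} {s} flat (Vertical⇒≡ {q₁} {s} vert)
    go (inj₂ vert₁)      (inj₂ vert₂)    = p≢s (cong₂ _,_ (Vertical⇒≡ {q₁} {s} vert₁)
      (fall-joint-injective {c , i} {not c , j} (λ eq → not≢ c (sym (cong proj₁ eq)))
        (same-fall {c} {i} {q₁} {b} ¬n ¬h refl {s} ¬nₛ ¬hₛ vert₁)
        (same-fall {not c} {j} {q₂} {b} ¬nn ¬n refl {s}
          (¬hₛ ∘ subst (λ c → Hit c (proj₂ s)) (Bool.not-involutive c)) ¬nₛ vert₂)))
      where
      ¬nₛ : ¬ Hit (not c) (proj₂ s)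
      ¬nₛ = Vertical-¬Hit {q₁} {s} {c} refl h₁ ¬n₁ vert₁

      ¬hₛ : ¬ Hit c (proj₂ s)
      ¬hₛ = Vertical-¬Hit {q₂} {s} {not c} (sym (Bool.not-involutive c)) n₂ ¬h₂ vert₂

  -- Absence of the cube

  hits : Vertex K → ℕ
  hits b = count (λ i → hit (false , i) b) + count (λ i → hit (true , i) b)

  hits-fall : ∀ c i b → hit (c , i) b ≡ false → hits b <ⁿ hits (fall (c , i) b)
  hits-fall false i b eq = +-mono-<-≤
    (count-< i eq (hit-fall _ b) (λ j j≢i → sym (hit-fall-≢ b (λ eq → j≢i (cong proj₂ eq)))))
    (≤-reflexive (count-cong (λ j → sym (hit-fall-≢ {true , j} {false , i} b λ ()))))
  hits-fall true i b eq = +-mono-≤-<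
    (≤-reflexive (count-cong (λ j → sym (hit-fall-≢ {false , j} {true , i} b λ ()))))
    (count-< i eq (hit-fall _ b) (λ j j≢i → sym (hit-fall-≢ b (λ eq → j≢i (cong proj₂ eq)))))

  -- For a flat edge and a fall with equal labels: a fall of side `d` tolerates hits on side `d`
  -- only, so the hit part and the part falling would be the same.
  part-clash : ∀ {b c d t} → hit (c , t) b ≡ true → hit (d , t) b ≡ false → ¬ Hit (not d) b → ⊥
  part-clash {b} {c} {d} {t} h u ¬h with c Bool.≟ d
  ... | no c≢d = ¬h (t , subst (λ c → hit (c , t) b ≡ true) (Bool.¬-not c≢d) h)
  ... | yes refl with () ← trans (sym h) u

  -- At a vertex of the copy with fewest hit parts no fall ends. Label each of its M + 1 edges by a
  -- part: a fall by the part it falls in, a flat edge by a hit part. No two labels agree.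
  layered-free : ¬ HasCopy (hypercube (suc M)) layered
  layered-free (f , inj , hom) = climb (suc (hits (proj₂ (g start)))) start ≤-refl
    where
    g : Vertex (suc M) → Point
    g = split ∘ f

    start : Vertex (suc M)
    start = replicate (suc M) false

    g-injective : ∀ {y z} → g y ≡ g z → y ≡ z
    g-injective eq = inj (split-injective eq)

    edge : ∀ y i → Edge (g y) (g (toggle i y))
    edge y i = hom {y} {toggle i y} (toggle-adj i y)

    Down : Vertex (suc M) → Fin (suc M) → Set
    Down y i = Flat (g y) (g (toggle i y)) ⊎ Fall (g y) (g (toggle i y))

    -- The side is dropped, which leaves `M` labels for `M + 1` edges. Equal labels may thus belong
    -- to falls of opposite sides, the case excluded by `no-fall-square`.
    label : ∀ {y i} → Down y i → Fin M
    label (inj₁ (_ , _ , (t , _) , _)) = t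
    label (inj₂ (_ , _ , t , _))       = t

    module _ (y : Vertex (suc M)) (i j : Fin (suc M)) (i≢j : i ≢ j) where
      p q₁ q₂ s : Point
      p  = g y
      q₁ = g (toggle i y)
      q₂ = g (toggle j y)
      s  = g (toggle j (toggle i y))

      e₁ : Edge q₁ s
      e₁ = edge (toggle i y) j

      e₂ : Edge q₂ s
      e₂ = subst (λ z → Edge q₂ (g z)) (toggle-comm i j y i≢j) (edge (toggle j y) i)

      q₁≢q₂ : q₁ ≢ q₂
      q₁≢q₂ eq = i≢j (toggle-injective i j y (g-injective eq))

      p≢s : p ≢ s
      p≢s eq = i≢j (toggle-injective i j y (sym
        (trans (cong (toggle j) (g-injective eq)) (toggle-involutive j (toggle i y)))))

      clash : (d₁ : Down y i) (d₂ : Down y j) → label d₁ ≢ label d₂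
      clash (inj₁ flat₁) (inj₁ flat₂) _ = no-flat-square {p} {q₁} {q₂} {s} flat₁ flat₂ e₁ e₂ q₁≢q₂ p≢s
      clash (inj₁ (_ , _ , (t , h) , _)) (inj₂ (_ , d , _ , u , _ , ¬h)) refl =
        part-clash {d = d} {t} h u ¬h
      clash (inj₂ (_ , d , _ , u , _ , ¬h)) (inj₁ (_ , _ , (t , h) , _)) refl =
        part-clash {d = d} {t} h u ¬h
      clash (inj₂ (x₁ , c , t , _ , b₁ , ¬n)) (inj₂ (x₂ , d , _ , _ , b₂ , ¬nd)) refl with d Bool.≟ c
      ... | yes refl = q₁≢q₂ (cong₂ _,_ (trans (sym x₁) x₂) (trans b₁ (sym b₂)))
      ... | no neq   = no-fall-square {proj₁ p} {proj₂ p} {q₁} {q₂} {s} c t t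
        (¬nd ∘ subst (λ c → Hit c (proj₂ p)) (Bool.¬-not (neq ∘ sym))) ¬n
        (cong₂ _,_ (sym x₁) b₁)
        (cong₂ _,_ (sym x₂) (trans b₂ (cong (λ d → fall (d , t) (proj₂ p)) (Bool.¬-not neq))))
        e₁ e₂ p≢s

    -- Descent replaces the choice of a minimum: while a fall ends at `y`, pass to its start, which
    -- has fewer hits. The number `k` bounds the remaining moves.
    climb : ∀ k y → hits (proj₂ (g y)) <ⁿ k → ⊥
    climb (suc k) y (s≤s le) with any? (λ i → Fall? (g (toggle i y)) (g y))
    ... | yes (i , _ , c , t , u , eq , _) = climb k (toggle i y)
      (<-≤-trans (subst (λ b → hits (proj₂ (g (toggle i y))) <ⁿ hits b) (sym eq)
                     (hits-fall c t (proj₂ (g (toggle i y))) u)) le)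
    ... | no none =
      let i , j , i<j , eq = pigeonhole (n<1+n M) (λ i → label {y} {i} (down i))
      in clash y i j (Fin.<⇒≢ i<j) (down i) (down j) eq
      where
      down : ∀ i → Down y i
      down i with edge y i
      ... | inj₁ flat        = inj₁ flat
      ... | inj₂ (inj₁ fall) = inj₂ fall
      ... | inj₂ (inj₂ rise) = contradiction (i , rise) none

  -- Completion of a cube by an edge over a point without hits

  exposed : Vertex K → Bool
  exposed b = isYes (Hit? false b ⊎-dec Hit? true b)

  module _ (c : Bool) where
    -- Lets the parts selected by `S` fall. The map `ι` keeps track of the original parts while the
    -- recursion passes to tails of `S`.
    walk : ∀ {N} → (Fin N → Fin M) → Vertex N → Vertex K → Vertex K
    walk ι []          b = b
    walk ι (false ∷ S) b = walk (ι ∘ suc) S b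
    walk ι (true  ∷ S) b = fall (c , ι zero) (walk (ι ∘ suc) S b)

    walk-other : ∀ {N} (ι : Fin N → Fin M) S b t → (∀ i → t ≢ (c , ι i)) → hit t (walk ι S b) ≡ hit t b
    walk-other ι []          b t t∉ = refl
    walk-other ι (false ∷ S) b t t∉ = walk-other (ι ∘ suc) S b t (t∉ ∘ suc)
    walk-other ι (true  ∷ S) b t t∉ =
      trans (hit-fall-≢ _ (t∉ zero)) (walk-other (ι ∘ suc) S b t (t∉ ∘ suc))

    -- `S` can be read off from the hits at the end of the walk. This gives injectivity of the cube
    -- and shows that an unselected part can still fall.
    hit-walk : ∀ {N} (ι : Fin N → Fin M) → Injective _≡_ _≡_ ι → ∀ S b → ¬ Hit c b → ∀ i →
               hit (c , ι i) (walk ι S b) ≡ lookup S i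
    hit-walk ι inj (false ∷ S) b ¬h zero = trans
      (walk-other (ι ∘ suc) S b _ (λ i eq → Fin.0≢1+n (inj (cong proj₂ eq))))
      (Bool.¬-not (λ h → ¬h (_ , h)))
    hit-walk ι inj (true  ∷ S) b ¬h zero = hit-fall _ _
    hit-walk ι inj (false ∷ S) b ¬h (suc i) = hit-walk (ι ∘ suc) (Fin.suc-injective ∘ inj) S b ¬h i
    hit-walk ι inj (true  ∷ S) b ¬h (suc i) = trans
      (hit-fall-≢ _ (λ eq → Fin.0≢1+n (sym (inj (cong proj₂ eq)))))
      (hit-walk (ι ∘ suc) (Fin.suc-injective ∘ inj) S b ¬h i)

    Step : ∀ {N} → (Fin N → Fin M) → Vertex K → Vertex N → Vertex N → Set
    Step ι b S R = ∃[ i ] (lookup S i ≡ false × walk ι R b ≡ fall (c , ι i) (walk ι S b))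

    -- The additional fall takes place inside the fall of part `ι zero`; falls in different blocks
    -- commute, so it can be moved outermost.
    Step-∷ : ∀ {N} (ι : Fin (suc N) → Fin M) → Injective _≡_ _≡_ ι → ∀ b S R x →
             Step (ι ∘ suc) b S R → Step ι b (x ∷ S) (x ∷ R)
    Step-∷ ι inj b S R false (i , u , eq) = suc i , u , eq
    Step-∷ ι inj b S R true  (i , u , eq) = suc i , u , trans
      (cong (fall (c , ι zero)) eq)
      (fall-comm _ (λ eq → Fin.0≢1+n (inj (cong proj₂ eq))))

    walk-step : ∀ {N} (ι : Fin N → Fin M) → Injective _≡_ _≡_ ι → ∀ b S R → differences S R ≡ 1 →
                Step ι b S R ⊎ Step ι b R S
    walk-step ι inj b []          []          ()
    walk-step ι inj b (false ∷ S) (false ∷ R) SR = ⊎-map (Step-∷ ι inj b S R false) (Step-∷ ι inj b R S false)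
      (walk-step (ι ∘ suc) (Fin.suc-injective ∘ inj) b S R SR)
    walk-step ι inj b (true  ∷ S) (true  ∷ R) SR = ⊎-map (Step-∷ ι inj b S R true) (Step-∷ ι inj b R S true)
      (walk-step (ι ∘ suc) (Fin.suc-injective ∘ inj) b S R SR)
    walk-step ι inj b (false ∷ S) (true  ∷ R) SR with refl ← tails≡ {u = S} {R} SR = inj₁ (zero , refl , refl)
    walk-step ι inj b (true  ∷ S) (false ∷ R) SR with refl ← tails≡ {u = S} {R} SR = inj₂ (zero , refl , refl)

  layered-completes : ∀ {u v} (uv : Adj (hypercube (a + K)) u v) → ¬ Adj (exceptional a exposed) u v →
    HasCopy (hypercube (suc M)) (addEdge _≟ᵛ_ layered u v (adj⇒≢ (hypercube (a + K)) {u = u} {v} uv))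
  layered-completes {u} {v} uv ordinary = cube , cube-injective , λ {S} {R} → cube-edge S R
    where
    x y : Vertex a
    x = take a u
    y = take a v

    b : Vertex K
    b = drop a u

    c : Bool
    c = colour x y

    b≡ : b ≡ drop a v
    b≡ = decidable-stable (b ≟ᵛ drop a v) λ neq → ordinary (uv , inj₁ neq)

    ¬Hit-b : ∀ d → ¬ Hit d b
    ¬Hit-b d h = ordinary (uv , inj₂ (exp , subst (T ∘ exposed) b≡ exp))
      where
      side : ∀ d → Hit d b → Hit false b ⊎ Hit true b
      side false = inj₁
      side true  = inj₂

      exp : T (exposed b)
      exp = fromWitness (side d h)

    xy : differences x y ≡ 1
    xy = begin
      differences x y                                ≡⟨ +-identityʳ _ ⟨
      differences x y + 0                            ≡⟨ cong (differences x y +_) (differences-self b) ⟨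
      differences x y + differences b b              ≡⟨ cong (λ d → differences x y + differences b d) b≡ ⟩
      differences x y + differences b (drop a v)     ≡⟨ differences-split a u v ⟨
      differences u v                                ≡⟨ uv ⟩
      1                                              ∎
      where open ≡-Reasoning

    G : Graph (Vertex (a + K))
    G = addEdge _≟ᵛ_ layered u v (adj⇒≢ (hypercube (a + K)) {u = u} {v} uv)

    end : Bool → Vertex a
    end false = x
    end true  = y

    end-injective : ∀ {z z′} → end z ≡ end z′ → z ≡ z′
    end-injective {false} {false} eq = refl
    end-injective {false} {true}  eq = contradiction eq (adj⇒≢ (hypercube a) {u = x} {y} xy)
    end-injective {true}  {false} eq = contradiction (sym eq) (adj⇒≢ (hypercube a) {u = x} {y} xy)
    end-injective {true}  {true}  eq = refl

    at : Vertex M → Vertex K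
    at S = walk c id S b

    hit-at : ∀ S i → hit (c , i) (at S) ≡ lookup S i
    hit-at S = hit-walk c id id S b (¬Hit-b c)

    ¬Hit-at : ∀ S → ¬ Hit (not c) (at S)
    ¬Hit-at S (i , h) = ¬Hit-b (not c)
      (i , trans (sym (walk-other c id S b (not c , i) (λ _ eq → not≢ c (cong proj₁ eq)))) h)

    cube : Vertex (suc M) → Vertex (a + K)
    cube (z ∷ S) = end z ++ at S

    cube-injective : Injective _≡_ _≡_ cube
    cube-injective {z ∷ S} {z′ ∷ R} eq =
      let ends , ats = ++-injective (end z) (end z′) eq
      in cong₂ _∷_ (end-injective ends)
           (lookup-ext S R (λ i → trans (sym (hit-at S i)) (trans (cong (hit (c , i)) ats) (hit-at R i))))

    layered-edge : ∀ {w w′ e e′} → Edge (w , e) (w′ , e′) → Adj layered (w ++ e) (w′ ++ e′)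
    layered-edge {w} {w′} {e} {e′} = subst₂ Edge (sym (split-++ w e)) (sym (split-++ w′ e′))

    fall-edge : ∀ w S R → Step c id b S R → Fall (w , at S) (w , at R)
    fall-edge w S R (i , Sᵢ , eq) = refl , c , i , trans (hit-at S i) Sᵢ , eq , ¬Hit-at S

    none-hit : ∀ S → (∀ i → lookup S i ≡ false) → at S ≡ b
    none-hit S none = go id S none
      where
      go : ∀ {N} (ι : Fin N → Fin M) S → (∀ i → lookup S i ≡ false) → walk c ι S b ≡ b
      go ι []          none = refl
      go ι (false ∷ S) none = go (ι ∘ suc) S (none ∘ suc)
      go ι (true  ∷ S) none with () ← none zero

    -- Once some part of side `c` has fallen, the copy of the edge `uv` is flat. The only rung
    -- missing in `layered` is the one over `b`, and it is the added edge.
    rung : ∀ S → Adj G (x ++ at S) (y ++ at S)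
    rung S with Hit? c (at S)
    ... | yes h = inj₁ (layered-edge (inj₁ (refl , xy , h , ¬Hit-at S)))
    ... | no ¬h = inj₂ (inj₁ (trans (cong (x ++_) at≡b) (take++drop≡id a u) ,
                              trans (cong (y ++_) (trans at≡b b≡)) (take++drop≡id a v)))
      where
      at≡b : at S ≡ b
      at≡b = none-hit S λ i → trans (sym (hit-at S i)) (Bool.¬-not (λ h → ¬h (i , h)))

    rail : ∀ w S R → differences S R ≡ 1 → Adj G (w ++ at S) (w ++ at R)
    rail w S R SR = inj₁ (layered-edge (inj₂
      (⊎-map (fall-edge w S R) (fall-edge w R S) (walk-step c id id b S R SR))))

    cube-edge : ∀ S R → differences S R ≡ 1 → Adj G (cube S) (cube R)
    cube-edge (false ∷ S) (false ∷ R) SR = rail x S R SR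
    cube-edge (true  ∷ S) (true  ∷ R) SR = rail y S R SR
    cube-edge (false ∷ S) (true  ∷ R) SR with refl ← tails≡ {u = S} {R} SR = rung S
    cube-edge (true  ∷ S) (false ∷ R) SR with refl ← tails≡ {u = S} {R} SR =
      Graph.symmetric G {x ++ at S} {y ++ at S} (rung S)

-- The bound

emptyGraph : ∀ {V} → Graph V
emptyGraph = record { Adj = λ _ _ → ⊥ ; adj? = λ _ _ → no id ; symmetric = id ; irreflexive = id }

-- The fallback for cubes too small to contain all blocks; it also provides the existence of the
-- saturation number there.
sat-≤-hypercube : ∀ M n → ∃[ s ] (IsSat n (hypercube (suc M)) s × s ≤ e (hypercube n))
sat-≤-hypercube M n = sat-≤ (hypercube (suc M)) emptyGraph (hypercube n) (λ ())
  (λ (_ , _ , hom) → hom {origin} {toggle zero origin} (toggle-adj zero origin))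
  (λ uv ¬uv → contradiction uv ¬uv)
  where
  origin : Vertex (suc M)
  origin = replicate (suc M) false

sat-≤-exceptional : ∀ M r a → let K = (2 * M) * len r in
  ∃[ s ] (IsSat (a + K) (hypercube (suc M)) s × s ≤ e (hypercube (a + K)) ×
    s * 2 ^ r ≤ (2 ^ a * e (hypercube K)) * 2 ^ r + e (hypercube a) * (2 * M * 2 ^ K))
sat-≤-exceptional M r a =
  let s , isSat , s≤ = sat-≤ (hypercube (suc M)) layered (exceptional a exposed)
        (λ {u} {v} → layered⊆hypercube {u} {v}) layered-free (λ {u} {v} → layered-completes {u} {v})
  in s , isSat ,
     ≤-trans s≤ (edgeCount-mono {G = exceptional a exposed} {hypercube (a + K)} proj₁ (vertices (a + K))) ,
     (begin
       s * 2 ^ r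
         ≤⟨ *-monoˡ-≤ (2 ^ r) (≤-trans s≤ (e-exceptional a exposed)) ⟩
       (2 ^ a * e (hypercube K) + e (hypercube a) * h) * 2 ^ r
         ≡⟨ solve 4 (λ x q h p → (x :+ q :* h) :* p := x :* p :+ q :* (h :* p)) refl
              (2 ^ a * e (hypercube K)) (e (hypercube a)) h (2 ^ r) ⟩
       (2 ^ a * e (hypercube K)) * 2 ^ r + e (hypercube a) * (h * 2 ^ r)
         ≤⟨ +-monoʳ-≤ _ (*-monoʳ-≤ (e (hypercube a)) exposed-density) ⟩
       (2 ^ a * e (hypercube K)) * 2 ^ r + e (hypercube a) * (2 * M * 2 ^ K) ∎)
  where
  open ≤-Reasoning
  open +-*-Solver
  K : ℕ
  K = (2 * M) * len r

  open Parts (two-sided r M) using (hit; density)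
  open Layered (two-sided r M) a

  h : ℕ
  h = Σᵛ K (bit ∘ exposed)

  hitBit : Bool → Vertex K → ℕ
  hitBit c b = bit (isYes (Hit? c b))

  exposed-≤ : ∀ b → bit (exposed b) ≤ hitBit false b + hitBit true b
  exposed-≤ b = bit-isYes-≤ (Hit? false b ⊎-dec Hit? true b)
    [ (λ p → ≤-trans (≤-reflexive (sym (cong bit (isYes-true (Hit? false b) p)))) (m≤m+n _ _))
    , (λ p → ≤-trans (≤-reflexive (sym (cong bit (isYes-true (Hit? true b) p)))) (m≤n+m _ _)) ]

  side-density : ∀ c → Σᵛ K (hitBit c) * 2 ^ r ≤ M * 2 ^ K
  side-density c = union-bound M (λ i → hit (c , i)) (λ i → ≤-reflexive (density (c , i)))

  exposed-density : h * 2 ^ r ≤ 2 * M * 2 ^ K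
  exposed-density = begin
    h * 2 ^ r
      ≤⟨ *-monoˡ-≤ (2 ^ r) (Σᵛ-mono K exposed-≤) ⟩
    Σᵛ K (λ b → hitBit false b + hitBit true b) * 2 ^ r
      ≡⟨ cong (_* 2 ^ r) (Σᵛ-+ K (hitBit false) (hitBit true)) ⟩
    (Σᵛ K (hitBit false) + Σᵛ K (hitBit true)) * 2 ^ r
      ≡⟨ *-distribʳ-+ (2 ^ r) (Σᵛ K (hitBit false)) _ ⟩
    Σᵛ K (hitBit false) * 2 ^ r + Σᵛ K (hitBit true) * 2 ^ r
      ≤⟨ +-mono-≤ (side-density false) (side-density true) ⟩
    M * 2 ^ K + M * 2 ^ K
      ≡⟨ solve 2 (λ m p → m :* p :+ m :* p := con 2 :* m :* p) refl M (2 ^ K) ⟩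
    2 * M * 2 ^ K ∎

sat-bound-large : ∀ M r a → let n = a + (2 * M) * len r in 2 ^ r * 2 ^ r ≤ n →
  ∃[ s ] (IsSat n (hypercube (suc M)) s × s ≤ e (hypercube n) × s * 2 ^ r ≤ 4 * M * e (hypercube n))
sat-bound-large M r a r²≤n =
  let s , isSat , s≤t , bound = sat-≤-exceptional M r a
  in s , isSat , s≤t , *-cancelˡ-≤ 2 (begin
    2 * (s * p)
      ≤⟨ *-monoʳ-≤ 2 bound ⟩
    2 * ((2 ^ a * e (hypercube K)) * p + e (hypercube a) * (2 * M * 2 ^ K))
      ≡⟨ solve 6 (λ x k p q m y → con 2 :* ((x :* k) :* p :+ q :* (con 2 :* m :* y))
                 := x :* (con 2 :* k) :* p :+ (con 2 :* q) :* (con 2 :* m :* y)) refl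
           (2 ^ a) (e (hypercube K)) p (e (hypercube a)) M (2 ^ K) ⟩
    2 ^ a * (2 * e (hypercube K)) * p + (2 * e (hypercube a)) * (2 * M * 2 ^ K)
      ≡⟨ cong₂ (λ k q → 2 ^ a * k * p + q * (2 * M * 2 ^ K)) (2*e-hypercube K) (2*e-hypercube a) ⟩
    2 ^ a * (K * 2 ^ K) * p + a * 2 ^ a * (2 * M * 2 ^ K)
      ≡⟨ cong (λ l → 2 ^ a * (2 * M * l * 2 ^ K) * p + a * 2 ^ a * (2 * M * 2 ^ K)) (len≡2^ r) ⟩
    2 ^ a * (2 * M * p * 2 ^ K) * p + a * 2 ^ a * (2 * M * 2 ^ K)
      ≡⟨ solve 5 (λ x m p y a → x :* (con 2 :* m :* p :* y) :* p :+ a :* x :* (con 2 :* m :* y)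
                 := con 2 :* m :* (p :* p :+ a) :* (x :* y)) refl (2 ^ a) M p (2 ^ K) a ⟩
    -- The summand `p * p` stems from the `Q_K`-edges and `a` from the edges over exposed points.
    -- Both are at most `n`; this is where the block length must not exceed the square root of `n`.
    2 * M * (p * p + a) * (2 ^ a * 2 ^ K)
      ≤⟨ *-monoˡ-≤ (2 ^ a * 2 ^ K) (*-monoʳ-≤ (2 * M) (+-mono-≤ r²≤n (m≤m+n a K))) ⟩
    2 * M * (n + n) * (2 ^ a * 2 ^ K)
      ≡⟨ solve 3 (λ m n y → con 2 :* m :* (n :+ n) :* y := con 4 :* m :* (n :* y)) refl M n (2 ^ a * 2 ^ K) ⟩
    4 * M * (n * (2 ^ a * 2 ^ K))
      ≡⟨ cong (λ y → 4 * M * (n * y)) (^-distribˡ-+-* 2 a K) ⟨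
    4 * M * (n * 2 ^ n)
      ≡⟨ cong (4 * M *_) (2*e-hypercube n) ⟨
    4 * M * (2 * e (hypercube n))
      ≡⟨ solve 2 (λ m t → con 4 :* m :* (con 2 :* t) := con 2 :* (con 4 :* m :* t)) refl M (e (hypercube n)) ⟩
    2 * (4 * M * e (hypercube n)) ∎)
  where
  open ≤-Reasoning
  open +-*-Solver
  p K n : ℕ
  p = 2 ^ r
  K = (2 * M) * len r
  n = a + K

sat-bound : ∀ M r n → 2 ^ r * 2 ^ r ≤ n →
  ∃[ s ] (IsSat n (hypercube (suc M)) s × s ≤ e (hypercube n) × s * 2 ^ r ≤ 4 * M * e (hypercube n))
sat-bound M r n r²≤n with (2 * M) * len r ≤? n
... | yes K≤n with a , refl ← m≤n⇒∃[o]m+o≡n K≤n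
  rewrite +-comm ((2 * M) * len r) a = sat-bound-large M r a r²≤n
-- Here `2 ^ r * 2 ^ r ≤ n < 2 * M * 2 ^ r`, so `2 ^ r` is below `2 * M` and the trivial bound
-- `s ≤ e (hypercube n)` is good enough.
... | no K≰n =
  let s , isSat , s≤t = sat-≤-hypercube M n
  in s , isSat , s≤t , (begin
    s * 2 ^ r                 ≡⟨ *-comm s (2 ^ r) ⟩
    2 ^ r * s                 ≤⟨ *-mono-≤ 2^r≤4M s≤t ⟩
    4 * M * e (hypercube n)   ∎)
  where
  open ≤-Reasoning
  2^r≤4M : 2 ^ r ≤ 4 * M
  2^r≤4M = ≤-trans
    (<⇒≤ (*-cancelʳ-< (2 ^ r) (2 ^ r) (2 * M)
      (≤-<-trans r²≤n (subst (λ l → n <ⁿ 2 * M * l) (len≡2^ r) (≰⇒> K≰n)))))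
    (*-monoˡ-≤ M {2} {4} (s≤s (s≤s z≤n)))

-- Block lengths are powers of two, so the square root of `suc n` is met only up to a factor 2. The
-- lower bound on `2 ^ r` makes exposed points rare, the upper one keeps the blocks small.
√-scale : ∀ n → ∃[ r ] (2 ^ r * 2 ^ r ≤ suc n × suc n <ⁿ 4 * (2 ^ r * 2 ^ r))
√-scale zero = 0 , ≤-refl , s≤s (s≤s z≤n)
√-scale (suc n) with r , lo , hi ← √-scale n | 4 * (2 ^ r * 2 ^ r) ≤? suc (suc n)
... | no ≰n  = r , m≤n⇒m≤1+n lo , ≰⇒> ≰n
... | yes ≤n = suc r , subst (_≤ suc (suc n)) (sym step) ≤n , (begin-strict
    suc (suc n)                       ≤⟨ hi ⟩
    4 * (2 ^ r * 2 ^ r)               <⟨ m<m*n (4 * (2 ^ r * 2 ^ r)) 4 (s≤s (s≤s z≤n)) ⟩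
    4 * (2 ^ r * 2 ^ r) * 4           ≡⟨ *-comm (4 * (2 ^ r * 2 ^ r)) 4 ⟩
    4 * (4 * (2 ^ r * 2 ^ r))         ≡⟨ cong (4 *_) step ⟨
    4 * (2 ^ suc r * 2 ^ suc r)       ∎)
  where
  open ≤-Reasoning
  open +-*-Solver
  step : 2 ^ suc r * 2 ^ suc r ≡ 4 * (2 ^ r * 2 ^ r)
  step = solve 1 (λ p → (con 2 :* p) :* (con 2 :* p) := con 4 :* (p :* p)) refl (2 ^ r)
  instance
    _ : NonZero (4 * (2 ^ r * 2 ^ r))
    _ = >-nonZero (≤-<-trans z≤n hi)

-- The 8 is the 4 of `sat-bound` times the factor 2 lost in `√-scale`. The successor keeps the
-- constant positive for `M = 0` and contributes the `t` dropped in `square-bound`.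
constant : ℕ → ℕ
constant M = suc (8 * M)

square-bound : ∀ M {n r s t} → n <ⁿ 4 * (2 ^ r * 2 ^ r) → s * 2 ^ r ≤ 4 * M * t →
               s * s * n ≤ (constant M * t) * (constant M * t)
square-bound M {n} {r} {s} {t} n<4r² bound = begin
  s * s * n
    ≤⟨ *-monoʳ-≤ (s * s) (<⇒≤ n<4r²) ⟩
  s * s * (4 * (2 ^ r * 2 ^ r))
    ≡⟨ solve 2 (λ s p → s :* s :* (con 4 :* (p :* p)) := (con 2 :* (s :* p)) :* (con 2 :* (s :* p))) refl s (2 ^ r) ⟩
  (2 * (s * 2 ^ r)) * (2 * (s * 2 ^ r))
    ≤⟨ *-mono-≤ double double ⟩
  (constant M * t) * (constant M * t) ∎
  where
  open ≤-Reasoning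
  open +-*-Solver
  double : 2 * (s * 2 ^ r) ≤ constant M * t
  double = begin
    2 * (s * 2 ^ r)   ≤⟨ *-monoʳ-≤ 2 bound ⟩
    2 * (4 * M * t)   ≡⟨ solve 2 (λ m t → con 2 :* (con 4 :* m :* t) := con 8 :* m :* t) refl M t ⟩
    8 * M * t         ≤⟨ m≤n+m (8 * M * t) t ⟩
    constant M * t    ∎

-- Weakens the exponent 1/2 to 1/(2 + q): two factors carry the gain of `n`, and the other `q` are
-- compared by `s ≤ t`.
power-bound : ∀ {s t n} q → s ≤ t → s * s * n ≤ t * t → s ^ (2 + q) * n ≤ t ^ (2 + q)
power-bound {s} {t} {n} q s≤t s²n≤t² = begin
  s * (s * s ^ q) * n   ≡⟨ solve 3 (λ s p n → s :* (s :* p) :* n := p :* (s :* s :* n)) refl s (s ^ q) n ⟩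
  s ^ q * (s * s * n)   ≤⟨ *-mono-≤ (^-monoˡ-≤ q s≤t) s²n≤t² ⟩
  t ^ q * (t * t)       ≡⟨ solve 2 (λ t p → p :* (t :* t) := t :* (t :* p)) refl t (t ^ q) ⟩
  t ^ (2 + q)           ∎
  where
  open ≤-Reasoning
  open +-*-Solver

constantℚ : ℕ → ℚ
constantℚ M = mkℚ (ℤ.+ constant M) 0 (coprime-sym (1-coprimeTo (constant M)))

-- The fraction `1 / d` is brought into literal form so that its numerator and denominator compute
-- in `_≤[_/_^_]·_`. The denominator is exposed as `2 + q` for `power-bound`.
unit-fraction : ∀ d .{{_ : NonZero d}} → 2 ≤ d →
                ∃[ q ] ℤ.+ 1 / d ≡ mkℚ (ℤ.+ 1) (suc q) (1-coprimeTo (2 + q))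
unit-fraction (suc (suc q)) _ = q , normalize-coprime (1-coprimeTo (2 + q))
unit-fraction 1 (s≤s ())

exponent-form : ∀ k → ∃[ q ] exponent (2 + k) ≡ mkℚ (ℤ.+ 1) (suc q) (1-coprimeTo (2 + q))
exponent-form k = unit-fraction (7 * 3 ^ k) {{m*n≢0 7 (3 ^ k) {{_}} {{m^n≢0 3 k}}}}
  (≤-trans (s≤s (s≤s z≤n)) (m≤m*n 7 (3 ^ k) {{m^n≢0 3 k}}))

theorem1 : (m : ℕ) .{{_ : NonZero m}} →
    ∃[ c ] ∃[ a ] (0ℚ < c × 0ℚ < a × a ≡ exponent m ×
    ((n : ℕ) .{{_ : NonZero n}} →
    ∃[ s ] (IsSat n (hypercube m) s × s ≤[ c / n ^ a ]· e (hypercube n))))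
theorem1 1 = constantℚ 0 , _ , *<* (ℤ.+<+ (s≤s z≤n)) , *<* (ℤ.+<+ (s≤s z≤n)) , refl , λ { n@(suc n′) →
  let r , r²≤n , _ = √-scale n′
      s , isSat , _ , bound = sat-bound 0 r n r²≤n
      -- With `M = 0` the bound reads `s * 2 ^ r ≤ 0`: a graph without a copy of `Q_1` has no edges.
      s≡0 : s ≡ 0
      s≡0 = m*n≡0⇒m≡0 s (2 ^ r) {{m^n≢0 2 r}} (n≤0⇒n≡0 bound)
  in s , isSat , subst (λ s → (1 * s) ^ 1 * n ^ 1 ≤ (1 * e (hypercube n)) ^ 1) (sym s≡0) z≤n }
theorem1 (suc (suc k)) with q , eq ← exponent-form k rewrite eq =
  constantℚ M , _ , *<* (ℤ.+<+ (s≤s z≤n)) , *<* (ℤ.+<+ (s≤s z≤n)) , refl , λ { n@(suc n′) →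
  let r , r²≤n , n<4r² = √-scale n′
      s , isSat , s≤t , bound = sat-bound M r n r²≤n
      t = e (hypercube n)
  in s , isSat , subst₂ (λ s n → s ^ (2 + q) * n ≤ (constant M * t) ^ (2 + q))
       (sym (*-identityˡ s)) (sym (*-identityʳ n))
       (power-bound {s} {constant M * t} {n} q (≤-trans s≤t (m≤n*m t (constant M)))
         (square-bound M {n} {r} {s} {t} n<4r² bound)) }
  where M = suc k
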